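{- Suppose the following statement (Gvözdjak's Conjecture) holds: for every positive integer $n$ and all integers $x\neq y$ with $0\le x,y\le n-1$ such that $|x-y|\equiv\lfloor n/2\rfloor \pmod 2$, $|x-y|\le n/2$ and $(n-1)/2\le x+y\le (3n-3)/2$, there is a graceful permutation of length $n$ with first element $x$ and last element $y$. Then for every positive integer $\ell$ and every $S\subseteq D_{8\ell+2}\setminus\{e\}$ with $|S|=8\ell$, the group $D_{8\ell+2}$ has an $S$-sequencing.
   Context: $D_{2m}=\langle u,v : u^m=e=v^2,\ vu=u^{m-1}v\rangle$ is the dihedral group of order $2m$. A graceful permutation of length $n$ is an arrangement $(a_1,\dots,a_n)$ of $\{0,1,\dots,n-1\}$ whose absolute differences $|a_{i+1}-a_i|$ ($1\le i\le n-1$) are exactly $\{1,\dots,n-1\}$. For $S\subseteq G\setminus\{e\}$ with $|S|=k$, an $S$-sequencing of $G$ is an ordering $(g_1,\dots,g_k)$ of the elements of $S$ such that the partial products $h_0=e$, $h_i=g_1\cdots g_i$ are pairwise distinct. -}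

module Defs where

open import Algebra.Bundles using (Group)
open import Data.List.Base using (List; applyUpTo; drop; head; last; length; upTo; zipWith)
open import Data.List.Relation.Binary.Permutation.Propositional using (_↭_)
open import Data.List.Scans.Base using (scanl)
open import Data.Maybe.Base using (just)
open import Data.Nat.Base
  using (ℕ; zero; suc; _+_; _*_; _∸_; _≤_; _<_; ∣_-_∣; ⌊_/2⌋; _%_)
open import Data.Product.Base using (_×_; _,_; ∃-syntax)
open import Function.Bundles using (_⇔_)
open import Level using (Level; 0ℓ; _⊔_)
open import Relation.Binary.Core using (Rel)
open import Relation.Binary.PropositionalEquality.Core using (_≡_; _≢_)
open import Relation.Unary using (Pred)

import Data.List.Membership.Setoid as Membership
import Data.List.Relation.Unary.Unique.Setoid as Uniqueness

infixl 7 _∙_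
infix  8 _⁻¹
infixr 9 _^_

data Term (X : Set) : Set where
  gen : X → Term X
  ε   : Term X
  _∙_ : Term X → Term X → Term X
  _⁻¹ : Term X → Term X

_^_ : {X : Set} → Term X → ℕ → Term X
w ^ zero  = ε
w ^ suc n = w ∙ w ^ n

-- The least group congruence containing R; the presented group is the
-- setoid of terms modulo this relation.
data Congruence {X : Set} (R : Rel (Term X) 0ℓ) : Rel (Term X) 0ℓ where
  relation  : ∀ {x y} → R x y → Congruence R x y
  refl      : ∀ {x} → Congruence R x x
  sym       : ∀ {x y} → Congruence R x y → Congruence R y x
  trans     : ∀ {x y z} → Congruence R x y → Congruence R y z → Congruence R x z
  ∙-cong    : ∀ {x y z w} → Congruence R x y → Congruence R z w →
              Congruence R (x ∙ z) (y ∙ w)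
  ⁻¹-cong   : ∀ {x y} → Congruence R x y → Congruence R (x ⁻¹) (y ⁻¹)
  assoc     : ∀ x y z → Congruence R ((x ∙ y) ∙ z) (x ∙ (y ∙ z))
  identityˡ : ∀ x → Congruence R (ε ∙ x) x
  identityʳ : ∀ x → Congruence R (x ∙ ε) x
  inverseˡ  : ∀ x → Congruence R (x ⁻¹ ∙ x) ε
  inverseʳ  : ∀ x → Congruence R (x ∙ x ⁻¹) ε

⟨_∣_⟩ : (X : Set) → Rel (Term X) 0ℓ → Group 0ℓ 0ℓ
⟨ X ∣ R ⟩ = record
  { Carrier = Term X
  ; _≈_     = Congruence R
  ; _∙_     = _∙_
  ; ε       = ε
  ; _⁻¹     = _⁻¹
  ; isGroup = record
    { isMonoid = record
      { isSemigroup = record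
        { isMagma = record
          { isEquivalence = record { refl = refl ; sym = sym ; trans = trans }
          ; ∙-cong        = ∙-cong
          }
        ; assoc = assoc
        }
      ; identity = identityˡ , identityʳ
      }
    ; inverse = inverseˡ , inverseʳ
    ; ⁻¹-cong = ⁻¹-cong
    }
  }

data DihedralGenerator : Set where
  u v : DihedralGenerator

data DihedralRelation (m : ℕ) : Rel (Term DihedralGenerator) 0ℓ where
  u^m≈ε      : DihedralRelation m (gen u ^ m) ε
  v^2≈ε      : DihedralRelation m (gen v ^ 2) ε
  vu≈u^m-1∙v : DihedralRelation m (gen v ∙ gen u) (gen u ^ (m ∸ 1) ∙ gen v)

-- Indexed by m ≥ 1, where the order of the group is 2m.
Dihedral : ℕ → Group 0ℓ 0ℓ
Dihedral m = ⟨ DihedralGenerator ∣ DihedralRelation m ⟩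

module _ {c ℓ : Level} (G : Group c ℓ) where

  private
    module G = Group G
  open Membership G.setoid using (_∈_)
  open Uniqueness G.setoid using (Unique)

  -- Membership and uniqueness are up to the equality of G, so a predicate
  -- that admits an ordering automatically respects that equality.
  IsOrderingOf : {s : Level} → Pred G.Carrier s → List G.Carrier → Set (c ⊔ ℓ ⊔ s)
  IsOrderingOf S gs = Unique gs × (∀ x → x ∈ gs ⇔ S x)

  HasCardinality : {s : Level} → Pred G.Carrier s → ℕ → Set (c ⊔ ℓ ⊔ s)
  HasCardinality S k = ∃[ gs ] (IsOrderingOf S gs × length gs ≡ k)

  NonIdentity : Pred G.Carrier ℓ
  NonIdentity x = x G.≉ G.ε

  -- h₀ , h₁ , … , hₖ, including h₀ = e.
  partialProducts : List G.Carrier → List G.Carrier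
  partialProducts = scanl G._∙_ G.ε

  HasSequencing : {s : Level} → Pred G.Carrier s → Set (c ⊔ ℓ ⊔ s)
  HasSequencing S = ∃[ gs ] (IsOrderingOf S gs × Unique (partialProducts gs))

absoluteDifferences : List ℕ → List ℕ
absoluteDifferences as = zipWith ∣_-_∣ (drop 1 as) as

IsGracefulPermutation : ℕ → List ℕ → Set
IsGracefulPermutation n as =
  as ↭ upTo n × absoluteDifferences as ↭ applyUpTo suc (n ∸ 1)

-- The bounds |x-y| ≤ n/2 and (n-1)/2 ≤ x+y ≤ (3n-3)/2 are between rational
-- numbers and are stated with the denominator 2 cleared.
GvözdjakConjecture : Set
GvözdjakConjecture =
  ∀ (n x y : ℕ) → 0 < n → x ≢ y → x ≤ n ∸ 1 → y ≤ n ∸ 1 →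
  ∣ x - y ∣ % 2 ≡ ⌊ n /2⌋ % 2 →
  2 * ∣ x - y ∣ ≤ n →
  n ∸ 1 ≤ 2 * (x + y) →
  2 * (x + y) ≤ 3 * n ∸ 3 →
  ∃[ as ] (IsGracefulPermutation n as × head as ≡ just x × last as ≡ just y)

{-# OPTIONS --safe #-}
module Submission where

-- A sequencing of S is a path through all elements of the group but one whose
-- quotients h⁻¹h′ of consecutive vertices run through S, that is, through all
-- nonidentity elements except a single one.  Up to the automorphisms
-- u ↦ u^k, v ↦ u^j v the exception is a reflection, or u^r with r odd.
--
-- Place one copy of a graceful permutation of length 2ℓ among the rotations u^a
-- and one among the reflections u^a v, on the same 2ℓ values of a.  Together their
-- edges have the quotients u^d and u^-d for each 0 < d < 2ℓ.  Zigzags between the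
-- remaining rotations and reflections have consecutive quotients u^c v, and they
-- are joined to the copies so that every c occurs.  This already settles the
-- reflections and r = 2ℓ, which is equivalent to r = 1.
--
-- To avoid u^r, cut both copies at their edge of difference r and run through
-- the second part, a zigzag and the first part, first on one side and then on the
-- other.  Of the four cut ends, whose positions are unknown, two are the ends of
-- the path and the other two are connected by the quotient u^-r v, which the
-- zigzags omit.  The endpoints (2s , ℓ) with r = 2s + 1 make all other connections
-- fit; they are admissible for 1 ≤ s ≤ ℓ - 2 and 2s ≠ ℓ, and the other r reduce
-- to r = 3 by doubling, except when m = 9.

open import Algebra.Bundles using (Group)
import Algebra.Properties.Group as GroupProperties
open import Data.Fin.Base using (Fin; toℕ; fromℕ<)
import Data.Fin.Properties as Finₚ
open import Data.Integer.Base as ℤ using (ℤ; +_)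
open import Data.Integer.DivMod using (_%ℕ_; _/ℕ_; n%ℕd<d; a≡a%ℕn+[a/ℕn]*n)
import Data.Integer.Properties as ℤₚ
open import Data.Integer.Tactic.RingSolver using (solve-∀)
open import Data.List.Base using (List; []; _∷_; _++_; map; length; head; last; upTo; inits)
open import Data.List.Membership.DecPropositional using (_∈?_)
open import Data.List.Membership.Propositional using (_∈_; _∉_; find)
open import Data.List.Membership.Propositional.Properties using (∈-++⁺ˡ; ∈-++⁺ʳ; ∈-++⁻; ∈-∃++; ∈-map⁺; ∈-applyUpTo⁺; ∈-upTo⁺; ∈-map⁻; ∈-upTo⁻)
open import Data.List.Properties using (length-++; length-map; length-upTo; map-∘)
open import Data.List.Relation.Binary.Permutation.Propositional using (↭-sym)
open import Data.List.Relation.Binary.Permutation.Propositional.Properties using (∈-resp-↭; ↭-length)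
open import Data.List.Relation.Binary.Pointwise using (Pointwise; []; _∷_)
open import Data.List.Relation.Unary.All as All using (All; []; _∷_; all?)
open import Data.List.Relation.Unary.All.Properties using (¬Any⇒All¬; All¬⇒¬Any; ¬All⇒Any¬)
open import Data.List.Relation.Unary.AllPairs as AllPairs using ([]; _∷_; AllPairs)
import Data.List.Relation.Unary.AllPairs.Properties as AllPairsₚ
open import Data.List.Relation.Unary.Any as Any using (here; there; Any; any?)
import Data.List.Relation.Unary.Any.Properties as Anyₚ
open import Data.List.Relation.Unary.Unique.Propositional using (Unique)
open import Data.List.Relation.Unary.Unique.Propositional.Properties using (upTo⁺)
open import Data.List.Scans.Base using (scanl)
open import Data.List.Scans.Properties using (scanl-defn)
open import Data.Maybe.Base using (just)
open import Data.Nat.Base as ℕ using (ℕ; zero; suc; s≤s; z≤n; ∣_-_∣; ⌊_/2⌋; _%_)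
open import Data.Nat.DivMod using ([m+kn]%n≡m%n; m≡m%n+[m/n]*n)
import Data.Nat.Divisibility as ℕ∣
open import Data.Nat.Induction using (<-rec)
import Data.Nat.Properties as ℕₚ
open import Data.Nat.Tactic.RingSolver using () renaming (solve-∀ to ℕ-solve-∀)
open import Data.Product.Base using (_×_; _,_; ∃-syntax; proj₁; proj₂)
open import Data.Sum.Base using (_⊎_; inj₁; inj₂)
open import Data.Unit.Base using (tt)
open import Function.Base using (_∘_)
open import Function.Bundles using (mk⇔; Equivalence)
open import Level using (Level)
open import Relation.Binary.PropositionalEquality as ≡ using (_≡_; _≢_; refl; cong; cong₂; subst; module ≡-Reasoning)
import Relation.Binary.Reasoning.Setoid as SetoidReasoning
open import Relation.Nullary using (¬_; yes; no; contradiction; Dec)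
open import Relation.Nullary.Decidable using (map′; toWitness; _⊎-dec_)
open import Relation.Unary using (Pred; _⊆_)
open import Defs using (GvözdjakConjecture; IsGracefulPermutation; absoluteDifferences)

module ℤ-Operations where
  open import Data.Integer.Base public using (-_; _+_; _*_; _-_)

-- Arithmetic modulo 4ℓ + 1.

module Mod (ℓ : ℕ) where
  open ℤ-Operations

  -- Writing the modulus as a polynomial in the integer `L` lets the ring solver treat every wrap
  -- around `4ℓ + 1` as an identity in `L`.
  L M : ℤ
  L = + ℓ
  M = + 4 * L + + 1

  m : ℕ
  m = 4 ℕ.* ℓ ℕ.+ 1

  infix 4 _≈_ _by_
  -- The multiple is data: a congruence is proved by naming how often `M` is added and checking an
  -- integer identity, as in `+ 1 by eq L`.
  record _≈_ (a b : ℤ) : Set where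
    constructor _by_
    field
      multiple : ℤ
      equation : a ≡ b + multiple * M

  M≡m : M ≡ + m
  M≡m = ≡.trans (cong (_+ + 1) (≡.sym (ℤₚ.pos-* 4 ℓ))) (≡.sym (ℤₚ.pos-+ (4 ℕ.* ℓ) 1))

  ≡⇒≈ : ∀ {a b} → a ≡ b → a ≈ b
  ≡⇒≈ {a} refl = + 0 by eq a M
    where
    eq : ∀ a n → a ≡ a + + 0 * n
    eq = solve-∀

  ≈-sym : ∀ {a b} → a ≈ b → b ≈ a
  ≈-sym {_} {b} (k by refl) = - k by eq b k M
    where
    eq : ∀ b k n → b ≡ (b + k * n) + - k * n
    eq = solve-∀

  ≈-trans : ∀ {a b c} → a ≈ b → b ≈ c → a ≈ c
  ≈-trans {c = c} (k by refl) (l by refl) = l + k by eq c k l M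
    where
    eq : ∀ c k l n → (c + l * n) + k * n ≡ c + (l + k) * n
    eq = solve-∀

  +-cong-≈ : ∀ {a b c d} → a ≈ b → c ≈ d → a + c ≈ b + d
  +-cong-≈ {b = b} {d = d} (k by refl) (l by refl) = k + l by eq b d k l M
    where
    eq : ∀ b d k l n → (b + k * n) + (d + l * n) ≡ (b + d) + (k + l) * n
    eq = solve-∀

  neg-cong-≈ : ∀ {a b} → a ≈ b → - a ≈ - b
  neg-cong-≈ {b = b} (k by refl) = - k by eq b k M
    where
    eq : ∀ b k n → - (b + k * n) ≡ - b + - k * n
    eq = solve-∀

  *-congˡ-≈ : ∀ c {a b} → a ≈ b → c * a ≈ c * b
  *-congˡ-≈ c {b = b} (k by refl) = c * k by eq c b k M
    where
    eq : ∀ c b k n → c * (b + k * n) ≡ c * b + (c * k) * n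
    eq = solve-∀

  instance
    m-nonZero : ℕ.NonZero m
    m-nonZero = ℕ.>-nonZero (ℕₚ.m≤n+m 1 (4 ℕ.* ℓ))

  residue : ℤ → ℕ
  residue a = a %ℕ m

  residue<m : ∀ a → residue a ℕ.< m
  residue<m a = n%ℕd<d a m

  ≈residue : ∀ a → a ≈ + residue a
  ≈residue a = a /ℕ m by ≡.trans (a≡a%ℕn+[a/ℕn]*n a m) (cong (λ n → + residue a + (a /ℕ m) * n) (≡.sym M≡m))

  private
    M∣<m⇒≡0 : ∀ {d} → d ℕ.< m → ∀ k → + d ≡ k * M → d ≡ 0
    M∣<m⇒≡0 {zero}  _   _ _ = refl
    M∣<m⇒≡0 {suc d} d<m k e = contradiction
      (ℕ∣.divides ℤ.∣ k ∣ (≡.trans (cong ℤ.∣_∣ e)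
        (≡.trans (ℤₚ.abs-* k M) (cong (λ n → ℤ.∣ k ∣ ℕ.* ℤ.∣ n ∣) M≡m))))
      (ℕ∣.>⇒∤ d<m)

    +[i∸j]≈0⇒i≤j : ∀ {i j} → i ℕ.< m → j ℕ.≤ i → + i ≈ + j → i ℕ.≤ j
    +[i∸j]≈0⇒i≤j {i} {j} i<m j≤i (k by eq) =
      ℕₚ.m∸n≡0⇒m≤n (M∣<m⇒≡0 (ℕₚ.≤-<-trans (ℕₚ.m∸n≤m i j) i<m) k (begin
        + (i ℕ.∸ j)            ≡⟨ ℤₚ.⊖-≥ j≤i ⟨
        i ℤ.⊖ j                ≡⟨ ℤₚ.m-n≡m⊖n i j ⟨
        + i - + j              ≡⟨ cong (_- + j) eq ⟩
        + j + k * M - + j      ≡⟨ cancel (+ j) (k * M) ⟩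
        k * M                  ∎))
      where
      open ≡-Reasoning
      cancel : ∀ a b → a + b - a ≡ b
      cancel = solve-∀

  <m-≈⇒≡ : ∀ {i j} → i ℕ.< m → j ℕ.< m → + i ≈ + j → i ≡ j
  <m-≈⇒≡ {i} {j} i<m j<m i≈j with ℕₚ.≤-total j i
  ... | inj₁ j≤i = ℕₚ.≤-antisym (+[i∸j]≈0⇒i≤j i<m j≤i i≈j) j≤i
  ... | inj₂ i≤j = ℕₚ.≤-antisym i≤j (+[i∸j]≈0⇒i≤j j<m i≤j (≈-sym i≈j))

  data _≋±_ (a : ℤ) (j : ℕ) : Set where
    pos : a ≈ + j   → a ≋± j
    neg : a ≈ - + j → a ≋± j

  -- Since `m = 2 · 2ℓ + 1`, a residue above `2ℓ` is the negative of its complement in `m`, which is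
  -- at most `2ℓ`. All case distinctions on the exponents of steps start here.
  absolute-residue : ∀ a → ∃[ j ] (j ℕ.≤ 2 ℕ.* ℓ × a ≋± j)
  absolute-residue a with residue a ℕₚ.≤? 2 ℕ.* ℓ
  ... | yes j≤2ℓ = residue a , j≤2ℓ , pos (≈residue a)
  ... | no  j≰2ℓ = m ℕ.∸ residue a , bound , neg (≈-trans (≈residue a) (+ 1 by wrap))
    where
    2ℓ = 2 ℕ.* ℓ
    m≡ : m ≡ 2ℓ ℕ.+ suc 2ℓ
    m≡ = eq ℓ where
      eq : ∀ l → 4 ℕ.* l ℕ.+ 1 ≡ 2 ℕ.* l ℕ.+ suc (2 ℕ.* l)
      eq = ℕ-solve-∀
    bound : m ℕ.∸ residue a ℕ.≤ 2ℓ
    bound = ℕₚ.≤-trans (ℕₚ.∸-monoʳ-≤ m (ℕₚ.≰⇒> j≰2ℓ))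
      (ℕₚ.≤-reflexive (≡.trans (cong (ℕ._∸ suc 2ℓ) m≡) (ℕₚ.m+n∸n≡m 2ℓ (suc 2ℓ))))
    wrap : + residue a ≡ - + (m ℕ.∸ residue a) + + 1 * M
    wrap = begin
      + residue a                             ≡⟨ shift (+ residue a) (+ m) ⟩
      - (+ m - + residue a) + + 1 * + m       ≡⟨ cong₂ (λ x n → - x + + 1 * n) difference (≡.sym M≡m) ⟩
      - + (m ℕ.∸ residue a) + + 1 * M         ∎
      where
      open ≡-Reasoning
      shift : ∀ r n → r ≡ - (n - r) + + 1 * n
      shift = solve-∀
      difference : + m - + residue a ≡ + (m ℕ.∸ residue a)
      difference = ≡.trans (ℤₚ.m-n≡m⊖n m (residue a)) (ℤₚ.⊖-≥ (ℕₚ.<⇒≤ (residue<m a)))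

private variable
  A B : Set

-- Counting with lists.

module Pigeonhole where
  -- The head `x` of `xs` is deleted from `ys` as well; the other entries of `xs` survive there
  -- because none of them equals `x`.
  unique⊆⇒length≤ : {xs ys : List A} → Unique xs → (∀ {x} → x ∈ xs → x ∈ ys) → length xs ℕ.≤ length ys
  unique⊆⇒length≤ {xs = []} _ _ = z≤n
  unique⊆⇒length≤ {A = A} {xs = x ∷ xs} {ys} (x∉xs ∷ xs!) ⊆ys with ∈-∃++ (⊆ys (here refl))
  ... | as , bs , refl = ℕₚ.≤-trans (s≤s (unique⊆⇒length≤ xs! ⊆rest)) (ℕₚ.≤-reflexive lengths)
    where
    ⊆rest : ∀ {z} → z ∈ xs → z ∈ as ++ bs
    ⊆rest z∈xs with ∈-++⁻ as (⊆ys (there z∈xs))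
    ... | inj₁ z∈as         = ∈-++⁺ˡ z∈as
    ... | inj₂ (here refl)  = contradiction z∈xs (All¬⇒¬Any x∉xs)
    ... | inj₂ (there z∈bs) = ∈-++⁺ʳ as z∈bs
    lengths : suc (length (as ++ bs)) ≡ length (as ++ x ∷ bs)
    lengths = ≡.trans (cong suc (length-++ as)) (≡.trans (≡.sym (ℕₚ.+-suc (length as) (length bs))) (≡.sym (length-++ as)))

  drop-duplicate : ∀ {x : A} as {bs z} → x ∈ bs → z ∈ as ++ x ∷ bs → z ∈ as ++ bs
  drop-duplicate as x∈bs z∈ with ∈-++⁻ as z∈
  ... | inj₁ z∈as         = ∈-++⁺ˡ z∈as
  ... | inj₂ (here refl)  = ∈-++⁺ʳ as x∈bs
  ... | inj₂ (there z∈bs) = ∈-++⁺ʳ as z∈bs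

  length-insert : ∀ (as : List A) {x bs} → length (as ++ x ∷ bs) ≡ suc (length (as ++ bs))
  length-insert []       = refl
  length-insert (_ ∷ as) = cong suc (length-insert as)

  unique⁺ : {ys : List A} → (∀ as {y bs} → ys ≡ as ++ y ∷ bs → y ∉ bs) → Unique ys
  unique⁺ {ys = []}     _ = []
  unique⁺ {ys = y ∷ ys} h = ¬Any⇒All¬ ys (h [] refl) ∷ unique⁺ (λ as eq → h (y ∷ as) (cong (y ∷_) eq))

  -- A repeated entry could be deleted and `ys` would still cover `xs`, but with fewer entries than
  -- `xs` has. Thus the constructions below only have to show that everything is covered;
  -- distinctness follows by counting.
  covering⇒unique : {xs ys : List A} → Unique xs → (∀ {x} → x ∈ xs → x ∈ ys) → length ys ℕ.≤ length xs → Unique ys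
  covering⇒unique xs! xs⊆ys |ys|≤|xs| = unique⁺ λ { as {y} {bs} refl y∈bs →
    ℕₚ.<⇒≱ (ℕₚ.≤-trans (ℕₚ.≤-reflexive (≡.sym (length-insert as))) |ys|≤|xs|)
            (unique⊆⇒length≤ xs! (drop-duplicate as y∈bs ∘ xs⊆ys)) }

-- Adjacent entries of lists, concatenation and zigzags.

data Consecutive {A : Set} : List A → A → A → Set where
  here  : ∀ {a b xs} → Consecutive (a ∷ b ∷ xs) a b
  there : ∀ {a b x xs} → Consecutive xs a b → Consecutive (x ∷ xs) a b

module Links where
  ++⁺ˡ : ∀ {xs ys : List A} {a b} → Consecutive xs a b → Consecutive (xs ++ ys) a b
  ++⁺ˡ here      = here
  ++⁺ˡ (there c) = there (++⁺ˡ c)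

  ++⁺ʳ : ∀ (xs : List A) {ys a b} → Consecutive ys a b → Consecutive (xs ++ ys) a b
  ++⁺ʳ []       c = c
  ++⁺ʳ (_ ∷ xs) c = there (++⁺ʳ xs c)

  junction : ∀ (xs : List A) {ys a b} → last xs ≡ just a → head ys ≡ just b → Consecutive (xs ++ ys) a b
  junction (_ ∷ [])         {_ ∷ _} refl refl = here
  junction (_ ∷ xs@(_ ∷ _)) {ys} l h = there (junction xs {ys} l h)

  ++⁻ : ∀ (xs : List A) {ys a b} → Consecutive (xs ++ ys) a b →
        Consecutive xs a b ⊎ Consecutive ys a b ⊎ last xs ≡ just a × head ys ≡ just b
  ++⁻ []              c         = inj₂ (inj₁ c)
  ++⁻ (_ ∷ [])        {_ ∷ _} here = inj₂ (inj₂ (refl , refl))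
  ++⁻ (_ ∷ [])        (there c) = inj₂ (inj₁ c)
  ++⁻ (_ ∷ _ ∷ _)     here      = inj₁ here
  ++⁻ (_ ∷ xs@(_ ∷ _)) (there c) with ++⁻ xs c
  ... | inj₁ l = inj₁ (there l)
  ... | inj₂ r = inj₂ r

  map⁺ : ∀ (f : A → B) {xs a b} → Consecutive xs a b → Consecutive (map f xs) (f a) (f b)
  map⁺ f here      = here
  map⁺ f (there c) = there (map⁺ f c)

  split : ∀ {xs : List A} {a b} → Consecutive xs a b →
          ∃[ ps ] ∃[ qs ] (xs ≡ ps ++ qs × last ps ≡ just a × head qs ≡ just b)
  split {xs = a ∷ b ∷ xs} here = a ∷ [] , b ∷ xs , refl , refl , refl
  split {xs = x ∷ xs} (there c) with split c
  ... | p ∷ ps , qs , refl , l , h = x ∷ p ∷ ps , qs , refl , l , h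

  last-++ : ∀ (xs : List A) {ys a} → last ys ≡ just a → last (xs ++ ys) ≡ just a
  last-++ []               l = l
  last-++ (_ ∷ [])         {_ ∷ _} l = l
  last-++ (_ ∷ xs@(_ ∷ _)) l = last-++ xs l

  head-++ : ∀ {xs ys : List A} {a} → head xs ≡ just a → head (xs ++ ys) ≡ just a
  head-++ {xs = _ ∷ _} h = h

  head-map : ∀ (f : A → B) {xs a} → head xs ≡ just a → head (map f xs) ≡ just (f a)
  head-map f {_ ∷ _} refl = refl

  last-map : ∀ (f : A → B) xs {a} → last xs ≡ just a → last (map f xs) ≡ just (f a)
  last-map f (_ ∷ [])         refl = refl
  last-map f (_ ∷ xs@(_ ∷ _)) l    = last-map f xs l

  -- The value of `head ys` makes `ys` nonempty, so that the last entry cannot come from `xs`.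
  last-prefix : ∀ (xs : List A) {ys a b} → head ys ≡ just b → last (xs ++ ys) ≡ just a → last ys ≡ just a
  last-prefix []               h l = l
  last-prefix (_ ∷ [])         {_ ∷ _} h l = l
  last-prefix (_ ∷ xs@(_ ∷ _)) h l = last-prefix xs h l

  head-suffix : ∀ {xs ys : List A} {a b} → last xs ≡ just b → head (xs ++ ys) ≡ just a → head xs ≡ just a
  head-suffix {xs = _ ∷ _} _ h = h

module Alternation where
  -- The zigzags. With `ro⁻` and `re⁺` the pair at index `i` has quotient `u^(2i) v` and the passage
  -- to index `i + 1` has `u^(2i+1) v`; with `re⁻` and `ro⁺` the exponents are the negatives. A
  -- zigzag thus runs through consecutive exponents.
  alternate : (ℕ → A) → (ℕ → A) → ℕ → ℕ → List A
  alternate f g i zero    = []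
  alternate f g i (suc k) = f i ∷ g i ∷ alternate f g (suc i) k

  private
    step : ∀ {i j k} → j ℕ.< i ℕ.+ suc k → j ℕ.< suc i ℕ.+ k
    step {i} {j} {k} = subst (j ℕ.<_) (ℕₚ.+-suc i k)

    empty : ∀ {P : Set} {i j} → i ℕ.≤ j → j ℕ.< i ℕ.+ 0 → P
    empty {i = i} i≤j j< = contradiction i≤j (ℕₚ.<⇒≱ (subst (_ ℕ.<_) (ℕₚ.+-identityʳ i) j<))

  module _ (f g : ℕ → A) where
    ∈-alternateˡ : ∀ {i j} k → i ℕ.≤ j → j ℕ.< i ℕ.+ k → f j ∈ alternate f g i k
    ∈-alternateˡ zero    i≤j j< = empty i≤j j<
    ∈-alternateˡ (suc k) i≤j j< with ℕₚ.m≤n⇒m<n∨m≡n i≤j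
    ... | inj₁ i<j  = there (there (∈-alternateˡ k i<j (step j<)))
    ... | inj₂ refl = here refl

    ∈-alternateʳ : ∀ {i j} k → i ℕ.≤ j → j ℕ.< i ℕ.+ k → g j ∈ alternate f g i k
    ∈-alternateʳ zero    i≤j j< = empty i≤j j<
    ∈-alternateʳ (suc k) i≤j j< with ℕₚ.m≤n⇒m<n∨m≡n i≤j
    ... | inj₁ i<j  = there (there (∈-alternateʳ k i<j (step j<)))
    ... | inj₂ refl = there (here refl)

    within : ∀ {i j} k → i ℕ.≤ j → j ℕ.< i ℕ.+ k → Consecutive (alternate f g i k) (f j) (g j)
    within zero    i≤j j< = empty i≤j j<
    within (suc k) i≤j j< with ℕₚ.m≤n⇒m<n∨m≡n i≤j
    ... | inj₁ i<j  = there (there (within k i<j (step j<)))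
    ... | inj₂ refl = here

    between : ∀ {i j} k → i ℕ.≤ j → suc j ℕ.< i ℕ.+ k → Consecutive (alternate f g i k) (g j) (f (suc j))
    between zero    i≤j j< = empty (ℕₚ.m≤n⇒m≤1+n i≤j) j<
    between {i} (suc k) i≤j j< with ℕₚ.m≤n⇒m<n∨m≡n i≤j
    between (suc k) i≤j j< | inj₁ i<j = there (there (between k i<j (step j<)))
    between (suc zero) i≤j j< | inj₂ refl = empty ℕₚ.≤-refl (step j<)
    between (suc (suc k)) i≤j j< | inj₂ refl = there here

    last-alternate : ∀ i k → last (alternate f g i (suc k)) ≡ just (g (k ℕ.+ i))
    last-alternate i zero    = refl
    last-alternate i (suc k) = ≡.trans (last-alternate (suc i) k) (cong (just ∘ g) (ℕₚ.+-suc k i))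

    length-alternate : ∀ i k → length (alternate f g i k) ≡ 2 ℕ.* k
    length-alternate i zero    = refl
    length-alternate i (suc k) = ≡.trans (cong (2 ℕ.+_) (length-alternate (suc i) k)) (≡.sym (ℕₚ.*-suc 2 k))

-- Dihedral elements, paths and automorphisms.

-- ro a and re a stand for u^a and u^a v.
data D : Set where
  ro re : ℤ → D

-- The quotient `d⁻¹e`. A reflection is its own inverse and `v u^b = u^-b v`, so the sign falls on
-- the second exponent exactly when the first argument is a reflection.
module _ where
  open ℤ-Operations

  infix 6 _\\_
  _\\_ : D → D → D
  ro a \\ ro b = ro (- a + b)
  ro a \\ re b = re (- a + b)
  re a \\ ro b = re (a - b)
  re a \\ re b = ro (a - b)

module Paths (ℓ : ℕ) where
  open ℤ-Operations

  open Mod ℓ public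

  infix 4 _≋_
  data _≋_ : D → D → Set where
    ro : ∀ {a b} → a ≈ b → ro a ≋ ro b
    re : ∀ {a b} → a ≈ b → re a ≋ re b

  ≋-refl : ∀ {d} → d ≋ d
  ≋-refl {ro _} = ro (≡⇒≈ refl)
  ≋-refl {re _} = re (≡⇒≈ refl)

  ≋-sym : ∀ {d e} → d ≋ e → e ≋ d
  ≋-sym (ro p) = ro (≈-sym p)
  ≋-sym (re p) = re (≈-sym p)

  ≋-trans : ∀ {d e f} → d ≋ e → e ≋ f → d ≋ f
  ≋-trans (ro p) (ro q) = ro (≈-trans p q)
  ≋-trans (re p) (re q) = re (≈-trans p q)

  ≡⇒≋ : ∀ {d e} → d ≡ e → d ≋ e
  ≡⇒≋ refl = ≋-refl

  -- Rotations are numbered below `m` and reflections from `m` on; this makes the congruence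
  -- decidable and allows counting in ℕ.
  code : D → ℕ
  code (ro a) = residue a
  code (re a) = m ℕ.+ residue a

  residue-cong : ∀ {a b} → a ≈ b → residue a ≡ residue b
  residue-cong {a} {b} a≈b = <m-≈⇒≡ (residue<m a) (residue<m b)
    (≈-trans (≈-sym (≈residue a)) (≈-trans a≈b (≈residue b)))

  residue-injective : ∀ {a b} → residue a ≡ residue b → a ≈ b
  residue-injective {a} {b} eq = ≈-trans (≈residue a) (≈-trans (≡⇒≈ (cong +_ eq)) (≈-sym (≈residue b)))

  code-cong : ∀ {d e} → d ≋ e → code d ≡ code e
  code-cong (ro p) = residue-cong p
  code-cong (re p) = cong (m ℕ.+_) (residue-cong p)

  code-injective : ∀ {d e} → code d ≡ code e → d ≋ e
  code-injective {ro a} {ro b} eq = ro (residue-injective eq)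
  code-injective {ro a} {re b} eq = contradiction (residue<m a) (ℕₚ.≤⇒≯ (subst (m ℕ.≤_) (≡.sym eq) (ℕₚ.m≤m+n m _)))
  code-injective {re a} {ro b} eq = contradiction (residue<m b) (ℕₚ.≤⇒≯ (subst (m ℕ.≤_) eq (ℕₚ.m≤m+n m _)))
  code-injective {re a} {re b} eq = re (residue-injective (ℕₚ.+-cancelˡ-≡ m _ _ eq))

  infix 4 _≋?_
  _≋?_ : ∀ d e → Dec (d ≋ e)
  d ≋? e = map′ code-injective code-cong (code d ℕₚ.≟ code e)

  labels : List D → List D
  labels (x ∷ ds@(y ∷ _)) = x \\ y ∷ labels ds
  labels _                = []

  Visits : List D → D → Set
  Visits ds d = ∃[ x ] (x ∈ ds × d ≋ x)

  Step : List D → D → Set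
  Step ds d = ∃[ x ] ∃[ y ] (Consecutive ds x y × d ≋ x \\ y)

  Step⇒Any : ∀ {ds d} → Step ds d → Any (d ≋_) (labels ds)
  Step⇒Any (_ , _ , here , p) = here p
  Step⇒Any {_ ∷ _ ∷ _} (_ , _ , there c , p) = there (Step⇒Any (_ , _ , c , p))

  Any⇒Step : ∀ ds {d} → Any (d ≋_) (labels ds) → Step ds d
  Any⇒Step (_ ∷ _ ∷ _)        (here p) = _ , _ , here , p
  Any⇒Step (_ ∷ ds@(_ ∷ _)) (there q) with Any⇒Step ds q
  ... | _ , _ , c , p = _ , _ , there c , p

  -- A path avoiding the quotient `e`, stated by coverage alone. There are `8ℓ + 2` elements, so
  -- `8ℓ + 1` vertices visiting all but one are distinct, and `8ℓ` steps covering all but the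
  -- identity and `e` are distinct and avoid both.
  record Path (e : D) : Set where
    field
      vertices        : List D
      length-vertices : length vertices ≡ suc (8 ℕ.* ℓ)
      unvisited       : D
      visits          : ∀ d → d ≋ unvisited ⊎ Visits vertices d
      steps           : ∀ d → d ≋ ro (+ 0) ⊎ d ≋ e ⊎ Step vertices d

  resp : ∀ {e e′} → e ≋ e′ → Path e → Path e′
  resp e≋e′ π = record
    { Path π
    ; steps = λ d → case-steps (Path.steps π d)
    }
    where
    case-steps : ∀ {d} → d ≋ _ ⊎ d ≋ _ ⊎ Step (Path.vertices π) d → d ≋ _ ⊎ d ≋ _ ⊎ Step (Path.vertices π) d
    case-steps (inj₁ p)        = inj₁ p
    case-steps (inj₂ (inj₁ p)) = inj₂ (inj₁ (≋-trans p e≋e′))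
    case-steps (inj₂ (inj₂ p)) = inj₂ (inj₂ p)

  -- The automorphism u ↦ u^k, v ↦ u^j v.
  module Affine (k j k⁻¹ : ℤ) (inverse : k * k⁻¹ ≈ + 1) where
    φ ψ : D → D
    φ (ro a) = ro (k * a)
    φ (re a) = re (k * a + j)
    ψ (ro a) = ro (k⁻¹ * a)
    ψ (re a) = re (k⁻¹ * (a - j))

    φ-cong : ∀ {d e} → d ≋ e → φ d ≋ φ e
    φ-cong (ro p) = ro (*-congˡ-≈ k p)
    φ-cong (re p) = re (+-cong-≈ (*-congˡ-≈ k p) (≡⇒≈ refl))

    cancel : ∀ a → a ≈ k * (k⁻¹ * a)
    cancel a = ≈-trans (≡⇒≈ (unit a)) (≈-trans (*-congˡ-≈ a (≈-sym inverse)) (≡⇒≈ (shuffle a k k⁻¹)))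
      where
      unit : ∀ a → a ≡ a * + 1
      unit = solve-∀
      shuffle : ∀ a k k′ → a * (k * k′) ≡ k * (k′ * a)
      shuffle = solve-∀

    φ∘ψ : ∀ d → d ≋ φ (ψ d)
    φ∘ψ (ro a) = ro (cancel a)
    φ∘ψ (re a) = re (≈-trans (≡⇒≈ (add a j)) (+-cong-≈ (cancel (a - j)) (≡⇒≈ refl)))
      where
      add : ∀ a j → a ≡ a - j + j
      add = solve-∀

    φ-\\ : ∀ d e → φ (d \\ e) ≡ φ d \\ φ e
    φ-\\ (ro a) (ro b) = cong ro (eq k a b)
      where
      eq : ∀ k a b → k * (- a + b) ≡ - (k * a) + k * b
      eq = solve-∀
    φ-\\ (ro a) (re b) = cong re (eq k j a b)
      where
      eq : ∀ k j a b → k * (- a + b) + j ≡ - (k * a) + (k * b + j)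
      eq = solve-∀
    φ-\\ (re a) (ro b) = cong re (eq k j a b)
      where
      eq : ∀ k j a b → k * (a - b) + j ≡ k * a + j - k * b
      eq = solve-∀
    φ-\\ (re a) (re b) = cong ro (eq k j a b)
      where
      eq : ∀ k j a b → k * (a - b) ≡ k * a + j - (k * b + j)
      eq = solve-∀

    transport : ∀ {d e} → ψ d ≋ e → d ≋ φ e
    transport {d} p = ≋-trans (φ∘ψ d) (φ-cong p)

    -- An automorphism carries quotients to quotients, so the image of the path omits `φ e`;
    -- coverage of `d` is reduced to coverage of `ψ d`.
    transportPath : ∀ {e} → Path e → Path (φ e)
    transportPath {e} π = record
      { vertices        = map φ vertices
      ; length-vertices = ≡.trans (length-map φ vertices) length-vertices
      ; unvisited       = φ unvisited
      ; visits          = λ d → visits′ (visits (ψ d))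
      ; steps           = λ d → steps′ (steps (ψ d))
      }
      where
      open Path π
      visits′ : ∀ {d} → ψ d ≋ unvisited ⊎ Visits vertices (ψ d) → d ≋ φ unvisited ⊎ Visits (map φ vertices) d
      visits′ (inj₁ p)            = inj₁ (transport p)
      visits′ (inj₂ (x , x∈ , p)) = inj₂ (φ x , ∈-map⁺ φ x∈ , transport p)
      steps′ : ∀ {d} → ψ d ≋ ro (+ 0) ⊎ ψ d ≋ e ⊎ Step vertices (ψ d) → d ≋ ro (+ 0) ⊎ d ≋ φ e ⊎ Step (map φ vertices) d
      steps′ (inj₁ p)        = inj₁ (≋-trans (transport p) (ro (≡⇒≈ (ℤₚ.*-zeroʳ k))))
      steps′ (inj₂ (inj₁ p)) = inj₂ (inj₁ (transport p))
      steps′ (inj₂ (inj₂ (x , y , c , p))) =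
        inj₂ (inj₂ (φ x , φ y , Links.map⁺ φ c , ≋-trans (transport p) (≡⇒≋ (φ-\\ x y))))

  negatePath : ∀ {a} → Path (ro a) → Path (ro (- a))
  negatePath {a} π = resp (ro (≡⇒≈ (ℤₚ.-1*i≡-i a))) (Affine.transportPath (- + 1) (+ 0) (- + 1) (≡⇒≈ refl) π)

  -- `2(2ℓ + 1) = m + 1`, so `2` is invertible modulo `m` with inverse `2ℓ + 1`; `halvePath` uses
  -- the same two multipliers exchanged.
  doublePath : ∀ {a} → Path (ro a) → Path (ro (+ 2 * a))
  doublePath = Affine.transportPath (+ 2) (+ 0) (+ 2 * L + + 1) (+ 1 by eq L)
    where
    eq : ∀ l → + 2 * (+ 2 * l + + 1) ≡ + 1 + + 1 * (+ 4 * l + + 1)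
    eq = solve-∀

  halvePath : ∀ {a} → Path (ro (+ 2 * a)) → Path (ro a)
  halvePath {a} π = resp (ro (a by eq′ L a)) (Affine.transportPath (+ 2 * L + + 1) (+ 0) (+ 2) (+ 1 by eq L) π)
    where
    eq : ∀ l → (+ 2 * l + + 1) * + 2 ≡ + 1 + + 1 * (+ 4 * l + + 1)
    eq = solve-∀
    eq′ : ∀ l a → (+ 2 * l + + 1) * (+ 2 * a) ≡ a + a * (+ 4 * l + + 1)
    eq′ = solve-∀

  -- The automorphism fixing `u` with `v ↦ u^(b-a) v` sends `u^a v` to `u^b v`, so a single
  -- reflection represents them all.
  translatePath : ∀ {a} b → Path (re a) → Path (re b)
  translatePath {a} b π = resp (re (≡⇒≈ (eq a b))) (Affine.transportPath (+ 1) (b - a) (+ 1) (≡⇒≈ refl) π)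
    where
    eq : ∀ a b → + 1 * a + (b - a) ≡ b
    eq = solve-∀

-- Graceful permutations in covering form.

module GracefulLists where
  -- What a path construction consumes: the ends, where the copies are joined to zigzags; the
  -- values, for the visited positions; and an edge for every difference from `1` to `n - 1`, for
  -- the steps.
  record Graceful (n x y : ℕ) : Set where
    field
      elements    : List ℕ
      length≡     : length elements ≡ n
      head≡       : head elements ≡ just x
      last≡       : last elements ≡ just y
      contains    : ∀ {p} → p ℕ.< n → p ∈ elements
      differences : ∀ {c} → suc c ℕ.< n → ∃[ a ] ∃[ b ] (Consecutive elements a b × ∣ b - a ∣ ≡ suc c)

  ∈-absoluteDifferences : ∀ as {c} → c ∈ absoluteDifferences as → ∃[ a ] ∃[ b ] (Consecutive as a b × ∣ b - a ∣ ≡ c)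
  ∈-absoluteDifferences (a ∷ b ∷ as) (here refl) = a , b , here , refl
  ∈-absoluteDifferences (a ∷ b ∷ as) (there c∈) with ∈-absoluteDifferences (b ∷ as) c∈
  ... | p , q , link , eq = p , q , there link , eq

  graceful : ∀ {n x y as} → IsGracefulPermutation n as → head as ≡ just x → last as ≡ just y → Graceful n x y
  graceful {suc n} {as = as} (as↭ , ds↭) h l = record
    { elements    = as
    ; length≡     = ≡.trans (↭-length as↭) (length-upTo (suc n))
    ; head≡       = h
    ; last≡       = l
    ; contains    = λ p<n → ∈-resp-↭ (↭-sym as↭) (∈-upTo⁺ p<n)
    ; differences = λ { (s≤s c<n) → ∈-absoluteDifferences as (∈-resp-↭ (↭-sym ds↭) (∈-applyUpTo⁺ suc c<n)) }
    }
  graceful {zero} {as = as} (as↭ , _) h l with as | ↭-length as↭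
  graceful {zero} _ () _ | [] | _

  data Parity : ℕ → Set where
    even : ∀ i → Parity (2 ℕ.* i)
    odd  : ∀ i → Parity (suc (2 ℕ.* i))

  parity : ∀ j → Parity j
  parity zero = even 0
  parity (suc j) with parity j
  ... | even i = odd i
  ... | odd i  = subst Parity (ℕₚ.*-suc 2 i) (even (suc i))

  distance : ∀ a b {c} → ∣ b - a ∣ ≡ c → b ≡ a ℕ.+ c ⊎ a ≡ b ℕ.+ c
  distance zero    b       refl = inj₁ (≡.sym (ℕₚ.∣-∣-identityʳ b))
  distance (suc a) zero    refl = inj₂ refl
  distance (suc a) (suc b) eq with distance a b eq
  ... | inj₁ p = inj₁ (cong suc p)
  ... | inj₂ p = inj₂ (cong suc p)

open GracefulLists
open Alternation
open Links

-- Placing the copies among the exponents.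

module Construction (ℓ : ℕ) where
  open ℤ-Operations

  open Paths ℓ

  2ℓ : ℕ
  2ℓ = 2 ℕ.* ℓ

  -- The position p of a graceful permutation is placed at p - 3ℓ ≡ p + ℓ + 1,
  -- so that the remaining positions form the symmetric interval [-ℓ , ℓ].
  emb : ℕ → ℤ
  emb p = L + + 1 + + p

  ro⁺ ro⁻ re⁺ re⁻ roᵉ reᵉ : ℕ → D
  ro⁺ i = ro (+ i)
  ro⁻ i = ro (- + i)
  re⁺ i = re (+ i)
  re⁻ i = re (- + i)
  roᵉ p = ro (emb p)
  reᵉ p = re (emb p)

  -- An absolute residue above `ℓ` is written `ℓ + 1 + k` with `k < ℓ`. Positive, it is `emb k`;
  -- negative, it wraps round to `3ℓ - k`, which is `emb (ℓ + o)` for `o = ℓ - 1 - k`.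
  position : ∀ a → (∃[ j ] (j ℕ.≤ ℓ × a ≋± j)) ⊎ (∃[ p ] (p ℕ.< 2ℓ × a ≈ emb p))
  position a with absolute-residue a
  ... | j , j≤2ℓ , r with j ℕₚ.≤? ℓ
  ...   | yes j≤ℓ = inj₁ (j , j≤ℓ , r)
  ...   | no  j≰ℓ with ℕₚ.m≤n⇒∃[o]m+o≡n (ℕₚ.≰⇒> j≰ℓ) | ℕₚ.m≤n⇒∃[o]m+o≡n j≤2ℓ
  ...     | k , refl | o , eq = inj₂ (shifted r)
    where
    ℓ≡ : suc k ℕ.+ o ≡ ℓ
    ℓ≡ = ℕₚ.+-cancelˡ-≡ ℓ _ _ (≡.trans (lhs ℓ k o) (≡.trans eq (rhs ℓ)))
      where
      lhs : ∀ l k o → l ℕ.+ (suc k ℕ.+ o) ≡ suc l ℕ.+ k ℕ.+ o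
      lhs = ℕ-solve-∀
      rhs : ∀ l → 2 ℕ.* l ≡ l ℕ.+ l
      rhs = ℕ-solve-∀
    k<ℓ : k ℕ.< ℓ
    k<ℓ = subst (suc k ℕ.≤_) ℓ≡ (ℕₚ.m≤m+n (suc k) o)
    o<ℓ : o ℕ.< ℓ
    o<ℓ = subst (suc o ℕ.≤_) ℓ≡ (s≤s (ℕₚ.m≤n+m o k))
    shifted : a ≋± (suc ℓ ℕ.+ k) → ∃[ p ] (p ℕ.< 2ℓ × a ≈ emb p)
    shifted (pos a≈) = k , ℕₚ.<-≤-trans k<ℓ (ℕₚ.m≤m+n ℓ _) , ≈-trans a≈ (≡⇒≈ (eq′ L (+ k)))
      where
      eq′ : ∀ l k → + 1 + l + k ≡ l + + 1 + k
      eq′ = solve-∀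
    shifted (neg a≈) = ℓ ℕ.+ o , ℕₚ.+-monoʳ-< ℓ (ℕₚ.<-≤-trans o<ℓ (ℕₚ.≤-reflexive (≡.sym (ℕₚ.+-identityʳ ℓ))))
      , ≈-trans a≈ (- + 1 by ≡.trans (cong (λ l → - (+ 1 + l + + k)) (≡.sym L≡)) (≡.trans (eq′ (+ k) (+ o)) (cong (λ l → l + + 1 + (l + + o) + - + 1 * (+ 4 * l + + 1)) L≡)))
      where
      L≡ : + 1 + + k + + o ≡ L
      L≡ = cong +_ ℓ≡
      eq′ : ∀ k o → - (+ 1 + (+ 1 + k + o) + k) ≡ (+ 1 + k + o) + + 1 + ((+ 1 + k + o) + o) + - + 1 * (+ 4 * (+ 1 + k + o) + + 1)
      eq′ = solve-∀

  step≈ : ∀ {ds x y d} → Consecutive ds x y → d ≋ x \\ y → Step ds d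
  step≈ c p = _ , _ , c , p

  -- The copies of an edge among the rotations and among the reflections
  -- give mutually inverse steps, so together they give both u^c and u^-c.
  module GracefulSteps {ds : List D} {a b c} (∣b-a∣≡c : ∣ b - a ∣ ≡ c)
    (ro-edge : Consecutive ds (roᵉ a) (roᵉ b))
    (re-edge : Consecutive ds (reᵉ a) (reᵉ b)) where

    private
      e₁ : ∀ l a c → c ≡ - (l + + 1 + a) + (l + + 1 + (a + c))
      e₁ = solve-∀
      e₂ : ∀ l a c → - c ≡ (l + + 1 + a) - (l + + 1 + (a + c))
      e₂ = solve-∀
      e₃ : ∀ l b c → - c ≡ - (l + + 1 + (b + c)) + (l + + 1 + b)
      e₃ = solve-∀
      e₄ : ∀ l b c → c ≡ (l + + 1 + (b + c)) - (l + + 1 + b)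
      e₄ = solve-∀

    step : ∀ {z} → z ≋± c → Step ds (ro z)
    step z≋ with distance a b ∣b-a∣≡c
    step (pos z≈) | inj₁ refl = step≈ ro-edge (ro (≈-trans z≈ (≡⇒≈ (e₁ L (+ a) (+ c)))))
    step (neg z≈) | inj₁ refl = step≈ re-edge (ro (≈-trans z≈ (≡⇒≈ (e₂ L (+ a) (+ c)))))
    step (pos z≈) | inj₂ refl = step≈ re-edge (ro (≈-trans z≈ (≡⇒≈ (e₄ L (+ b) (+ c)))))
    step (neg z≈) | inj₂ refl = step≈ ro-edge (ro (≈-trans z≈ (≡⇒≈ (e₃ L (+ b) (+ c)))))

-- Uncut copies: avoiding a reflection or `u^(2ℓ)`.

module UncutPaths (ℓ-1 : ℕ) where
  open ℤ-Operations

  ℓ : ℕ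
  ℓ = suc ℓ-1
  open Construction ℓ
  open Paths ℓ

  private
    +2* : ∀ i → + (2 ℕ.* i) ≡ + i + + i
    +2* i = cong +_ (cong (i ℕ.+_) (ℕₚ.+-identityʳ i))

    +2*+1 : ∀ i → + suc (2 ℕ.* i) ≡ + 1 + (+ i + + i)
    +2*+1 i = cong (λ z → + 1 + z) (+2* i)

  half-≤ : ∀ {i k} → 2 ℕ.* i ℕ.≤ 2 ℕ.* k → i ℕ.≤ k
  half-≤ = ℕₚ.*-cancelˡ-≤ 2

  half-< : ∀ {i k} → suc (2 ℕ.* i) ℕ.≤ 2 ℕ.* k → i ℕ.< k
  half-< = ℕₚ.*-cancelˡ-< 2 _ _

  pos-even : ∀ {a i} → a ≈ + (2 ℕ.* i) → a ≈ + i + + i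
  pos-even {i = i} p = ≈-trans p (≡⇒≈ (+2* i))
  pos-odd : ∀ {a i} → a ≈ + suc (2 ℕ.* i) → a ≈ + 1 + (+ i + + i)
  pos-odd {i = i} p = ≈-trans p (≡⇒≈ (+2*+1 i))
  neg-even : ∀ {a i} → a ≈ - + (2 ℕ.* i) → a ≈ - (+ i + + i)
  neg-even {i = i} p = ≈-trans p (≡⇒≈ (cong -_ (+2* i)))
  neg-odd : ∀ {a i} → a ≈ - + suc (2 ℕ.* i) → a ≈ - (+ 1 + (+ i + + i))
  neg-odd {i = i} p = ≈-trans p (≡⇒≈ (cong -_ (+2*+1 i)))

  ≈-≡ : ∀ {a b c} → a ≈ b → b ≡ c → a ≈ c
  ≈-≡ p e = ≈-trans p (≡⇒≈ e)

  -- The endpoints `0` and `ℓ` put the entrances of the copies at exponent `ℓ + 1` and their exits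
  -- at `2ℓ + 1`. The zigzags are left open, since the two paths below differ only there.
  module Sandwich (g : Graceful 2ℓ 0 ℓ) (Z₀ Z₁ : List D) where
    open Graceful g

    rotations reflections vertices : List D
    rotations   = map roᵉ elements
    reflections = map reᵉ elements
    vertices    = Z₀ ++ rotations ++ Z₁ ++ reflections

    ∈-Z₀ : ∀ {d} → d ∈ Z₀ → d ∈ vertices
    ∈-Z₀ = ∈-++⁺ˡ

    ∈-Z₁ : ∀ {d} → d ∈ Z₁ → d ∈ vertices
    ∈-Z₁ = ∈-++⁺ʳ Z₀ ∘ ∈-++⁺ʳ rotations ∘ ∈-++⁺ˡ

    ∈-rotations : ∀ {p} → p ℕ.< 2ℓ → roᵉ p ∈ vertices
    ∈-rotations p<2ℓ = ∈-++⁺ʳ Z₀ (∈-++⁺ˡ (∈-map⁺ roᵉ (contains p<2ℓ)))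

    ∈-reflections : ∀ {p} → p ℕ.< 2ℓ → reᵉ p ∈ vertices
    ∈-reflections p<2ℓ = ∈-++⁺ʳ Z₀ (∈-++⁺ʳ rotations (∈-++⁺ʳ Z₁ (∈-map⁺ reᵉ (contains p<2ℓ))))

    in-Z₀ : ∀ {a b} → Consecutive Z₀ a b → Consecutive vertices a b
    in-Z₀ = ++⁺ˡ

    in-Z₁ : ∀ {a b} → Consecutive Z₁ a b → Consecutive vertices a b
    in-Z₁ = ++⁺ʳ Z₀ ∘ ++⁺ʳ rotations ∘ ++⁺ˡ

    enter-rotations : ∀ {d} → last Z₀ ≡ just d → Consecutive vertices d (roᵉ 0)
    enter-rotations l = junction Z₀ l (head-++ {xs = rotations} (head-map roᵉ head≡))

    leave-rotations : ∀ {d} → head Z₁ ≡ just d → Consecutive vertices (roᵉ ℓ) d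
    leave-rotations h = ++⁺ʳ Z₀ (junction rotations (last-map roᵉ elements last≡) (head-++ {xs = Z₁} h))

    enter-reflections : ∀ {d} → last Z₁ ≡ just d → Consecutive vertices d (reᵉ 0)
    enter-reflections l = ++⁺ʳ Z₀ (++⁺ʳ rotations (junction Z₁ l (head-map reᵉ head≡)))

    short-step : ∀ {a j} → suc j ℕ.< 2ℓ → a ≋± suc j → Step vertices (ro a)
    short-step j<2ℓ a≋ with differences j<2ℓ
    ... | x , y , c , e = GracefulSteps.step e (++⁺ʳ Z₀ (++⁺ˡ (map⁺ roᵉ c)))
                            (++⁺ʳ Z₀ (++⁺ʳ rotations (++⁺ʳ Z₁ (map⁺ reᵉ c)))) a≋

    length-vertices : length vertices ≡ length Z₀ ℕ.+ (2ℓ ℕ.+ (length Z₁ ℕ.+ 2ℓ))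
    length-vertices = ≡.trans (length-++ Z₀) (cong (length Z₀ ℕ.+_)
      (≡.trans (length-++ rotations) (cong₂ ℕ._+_ (≡.trans (length-map _ elements) length≡)
      (≡.trans (length-++ Z₁) (cong (length Z₁ ℕ.+_) (≡.trans (length-map _ elements) length≡))))))

  -- `Z₀` has the quotients `u^c v` for `c = 2, …, 2ℓ` and `Z₁` those for `c = -1, …, -2ℓ`. The
  -- joints around the rotation copy give `u^(-2ℓ)` and `u^(2ℓ)`, and the joint into the reflection
  -- copy gives `u v`. Only the quotient `v` is absent, and the vertex `v` is the one not visited.
  module ReflectionPath (g : Graceful 2ℓ 0 ℓ) where
    Z₀ Z₁ : List D
    Z₀ = alternate re⁺ ro⁻ 1 ℓ
    Z₁ = ro (+ 0) ∷ alternate re⁻ ro⁺ 1 ℓ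

    open Sandwich g Z₀ Z₁

    visit : ∀ d → d ≋ re (+ 0) ⊎ Visits vertices d
    visit (ro a) with position a
    ... | inj₂ (p , p<2ℓ , a≈)          = inj₂ (_ , ∈-rotations p<2ℓ , ro a≈)
    ... | inj₁ (zero  , _   , pos a≈) = inj₂ (_ , ∈-Z₁ (here refl) , ro a≈)
    ... | inj₁ (zero  , _   , neg a≈) = inj₂ (_ , ∈-Z₁ (here refl) , ro a≈)
    ... | inj₁ (suc j , j≤ℓ , pos a≈) = inj₂ (_ , ∈-Z₁ (there (∈-alternateʳ re⁻ ro⁺ ℓ (s≤s z≤n) (s≤s j≤ℓ))) , ro a≈)
    ... | inj₁ (suc j , j≤ℓ , neg a≈) = inj₂ (_ , ∈-Z₀ (∈-alternateʳ re⁺ ro⁻ ℓ (s≤s z≤n) (s≤s j≤ℓ)) , ro a≈)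
    visit (re a) with position a
    ... | inj₂ (p , p<2ℓ , a≈)          = inj₂ (_ , ∈-reflections p<2ℓ , re a≈)
    ... | inj₁ (zero  , _   , pos a≈) = inj₁ (re a≈)
    ... | inj₁ (zero  , _   , neg a≈) = inj₁ (re a≈)
    ... | inj₁ (suc j , j≤ℓ , pos a≈) = inj₂ (_ , ∈-Z₀ (∈-alternateˡ re⁺ ro⁻ ℓ (s≤s z≤n) (s≤s j≤ℓ)) , re a≈)
    ... | inj₁ (suc j , j≤ℓ , neg a≈) = inj₂ (_ , ∈-Z₁ (there (∈-alternateˡ re⁻ ro⁺ ℓ (s≤s z≤n) (s≤s j≤ℓ))) , re a≈)

    rotation-step : ∀ a → a ≈ + 0 ⊎ Step vertices (ro a)
    rotation-step a with absolute-residue a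
    ... | zero , _ , pos a≈ = inj₁ a≈
    ... | zero , _ , neg a≈ = inj₁ a≈
    ... | suc j , j≤2ℓ , a≋ with ℕₚ.m≤n⇒m<n∨m≡n j≤2ℓ
    ...   | inj₁ j<2ℓ = inj₂ (short-step j<2ℓ a≋)
    ...   | inj₂ refl = inj₂ (long a≋)
      where
      long : a ≋± 2ℓ → Step vertices (ro a)
      long (pos a≈) = step≈ (leave-rotations refl) (ro (≈-trans (pos-even {i = ℓ} a≈) (+ 1 by eq L)))
        where
        eq : ∀ l → l + l ≡ - (l + + 1 + l) + + 0 + + 1 * (+ 4 * l + + 1)
        eq = solve-∀
      long (neg a≈) = step≈ (enter-rotations (last-alternate re⁺ ro⁻ 1 ℓ-1))
        (ro (≈-trans (neg-even {i = ℓ} a≈) (≈-trans (- + 1 by eq L)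
          (≡⇒≈ (cong (λ n → - - + n + (L + + 1 + + 0)) (ℕₚ.+-comm 1 ℓ-1))))))
        where
        eq : ∀ l → - (l + l) ≡ - - l + (l + + 1 + + 0) + - + 1 * (+ 4 * l + + 1)
        eq = solve-∀

    reflection-step : ∀ a → a ≈ + 0 ⊎ Step vertices (re a)
    reflection-step a with absolute-residue a
    ... | j , j≤2ℓ , a≋ with parity j
    reflection-step a | _ , _ , pos a≈ | even zero = inj₁ a≈
    reflection-step a | _ , _ , neg a≈ | even zero = inj₁ a≈
    reflection-step a | _ , j≤ , pos a≈ | even i@(suc _) =
      inj₂ (step≈ (in-Z₀ (within re⁺ ro⁻ ℓ (s≤s z≤n) (s≤s (half-≤ j≤)))) (re (≈-≡ (pos-even {i = i} a≈) (eq (+ i)))))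
      where
      eq : ∀ i → i + i ≡ i - - i
      eq = solve-∀
    reflection-step a | _ , j≤ , pos a≈ | odd zero =
      inj₂ (step≈ (enter-reflections (last-alternate re⁻ ro⁺ 1 ℓ-1))
        (re (≈-≡ a≈ (≡.trans (eq L) (cong (λ n → - + n + (L + + 1 + + 0)) (ℕₚ.+-comm 1 ℓ-1))))))
      where
      eq : ∀ l → + 1 ≡ - l + (l + + 1 + + 0)
      eq = solve-∀
    reflection-step a | _ , j≤ , pos a≈ | odd i@(suc _) =
      inj₂ (step≈ (in-Z₀ (between re⁺ ro⁻ ℓ (s≤s z≤n) (s≤s (half-< j≤)))) (re (≈-≡ (pos-odd {i = i} a≈) (eq (+ i)))))
      where
      eq : ∀ i → + 1 + (i + i) ≡ - - i + (+ 1 + i)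
      eq = solve-∀
    reflection-step a | _ , j≤ , neg a≈ | even i@(suc _) =
      inj₂ (step≈ (in-Z₁ (there (within re⁻ ro⁺ ℓ (s≤s z≤n) (s≤s (half-≤ j≤))))) (re (≈-≡ (neg-even {i = i} a≈) (eq (+ i)))))
      where
      eq : ∀ i → - (i + i) ≡ - i - i
      eq = solve-∀
    reflection-step a | _ , j≤ , neg a≈ | odd zero = inj₂ (step≈ (in-Z₁ here) (re a≈))
    reflection-step a | _ , j≤ , neg a≈ | odd i@(suc _) =
      inj₂ (step≈ (in-Z₁ (there (between re⁻ ro⁺ ℓ (s≤s z≤n) (s≤s (half-< j≤))))) (re (≈-≡ (neg-odd {i = i} a≈) (eq (+ i)))))
      where
      eq : ∀ i → - (+ 1 + (i + i)) ≡ - i + - (+ 1 + i)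
      eq = solve-∀

    path : Path (re (+ 0))
    path = record
      { vertices        = vertices
      ; length-vertices = ≡.trans length-vertices (≡.trans (cong₂ (λ p q → p ℕ.+ (2ℓ ℕ.+ (suc q ℕ.+ 2ℓ)))
                            (length-alternate re⁺ ro⁻ 1 ℓ) (length-alternate re⁻ ro⁺ 1 ℓ)) (eq ℓ))
      ; unvisited       = re (+ 0)
      ; visits          = visit
      ; steps           = λ { (ro a) → classify ro (rotation-step a) ; (re a) → classify′ (reflection-step a) }
      }
      where
      eq : ∀ l → 2 ℕ.* l ℕ.+ (2 ℕ.* l ℕ.+ (suc (2 ℕ.* l) ℕ.+ 2 ℕ.* l)) ≡ suc (8 ℕ.* l)
      eq = ℕ-solve-∀
      classify : ∀ {a d} → (a ≈ + 0 → d ≋ ro (+ 0)) → a ≈ + 0 ⊎ Step vertices d → d ≋ ro (+ 0) ⊎ d ≋ re (+ 0) ⊎ Step vertices d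
      classify f (inj₁ p) = inj₁ (f p)
      classify f (inj₂ s) = inj₂ (inj₂ s)
      classify′ : ∀ {a} → a ≈ + 0 ⊎ Step vertices (re a) → re a ≋ ro (+ 0) ⊎ re a ≋ re (+ 0) ⊎ Step vertices (re a)
      classify′ (inj₁ p) = inj₂ (inj₁ (re p))
      classify′ (inj₂ s) = inj₂ (inj₂ s)

  -- `Z₀` now ends in an extra rotation and has `c = 2, …, 2ℓ - 1`, while `Z₁` starts at `v` and has
  -- `c = 0, -1, …, -2ℓ`. Entering the rotation copy gives `u^(-2ℓ)`; leaving it for a reflection
  -- gives `u^(2ℓ) v`; the last joint gives `u v`. Hence the quotient `u^(2ℓ)` is lost, and the
  -- vertex `u^ℓ v` is left over.
  module LargestRotationPath (g : Graceful 2ℓ 0 ℓ) where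
    Z₀ Z₁ : List D
    Z₀ = alternate ro⁻ re⁺ 1 ℓ-1 ++ ro⁻ ℓ ∷ []
    Z₁ = alternate re⁻ ro⁺ 0 (suc ℓ)

    open Sandwich g Z₀ Z₁

    visit : ∀ d → d ≋ re⁺ ℓ ⊎ Visits vertices d
    visit (ro a) with position a
    ... | inj₂ (p , p<2ℓ , a≈)        = inj₂ (_ , ∈-rotations p<2ℓ , ro a≈)
    ... | inj₁ (j     , j≤ℓ , pos a≈) = inj₂ (_ , ∈-Z₁ (∈-alternateʳ re⁻ ro⁺ (suc ℓ) z≤n (s≤s j≤ℓ)) , ro a≈)
    ... | inj₁ (zero  , j≤ℓ , neg a≈) = inj₂ (_ , ∈-Z₁ (∈-alternateʳ re⁻ ro⁺ (suc ℓ) z≤n (s≤s j≤ℓ)) , ro a≈)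
    ... | inj₁ (suc j , j≤ℓ , neg a≈) with ℕₚ.m≤n⇒m<n∨m≡n j≤ℓ
    ...   | inj₁ j<ℓ  = inj₂ (_ , ∈-Z₀ (∈-++⁺ˡ (∈-alternateˡ ro⁻ re⁺ ℓ-1 (s≤s z≤n) j<ℓ)) , ro a≈)
    ...   | inj₂ refl = inj₂ (_ , ∈-Z₀ (∈-++⁺ʳ (alternate ro⁻ re⁺ 1 ℓ-1) (here refl)) , ro a≈)
    visit (re a) with position a
    ... | inj₂ (p , p<2ℓ , a≈)        = inj₂ (_ , ∈-reflections p<2ℓ , re a≈)
    ... | inj₁ (j     , j≤ℓ , neg a≈) = inj₂ (_ , ∈-Z₁ (∈-alternateˡ re⁻ ro⁺ (suc ℓ) z≤n (s≤s j≤ℓ)) , re a≈)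
    ... | inj₁ (zero  , j≤ℓ , pos a≈) = inj₂ (_ , ∈-Z₁ (∈-alternateˡ re⁻ ro⁺ (suc ℓ) z≤n (s≤s j≤ℓ)) , re a≈)
    ... | inj₁ (suc j , j≤ℓ , pos a≈) with ℕₚ.m≤n⇒m<n∨m≡n j≤ℓ
    ...   | inj₁ j<ℓ  = inj₂ (_ , ∈-Z₀ (∈-++⁺ˡ (∈-alternateʳ ro⁻ re⁺ ℓ-1 (s≤s z≤n) j<ℓ)) , re a≈)
    ...   | inj₂ refl = inj₁ (re a≈)

    rotation-step : ∀ a → ro a ≋ ro (+ 0) ⊎ ro a ≋ ro (+ 2ℓ) ⊎ Step vertices (ro a)
    rotation-step a with absolute-residue a
    ... | zero , _ , pos a≈ = inj₁ (ro a≈)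
    ... | zero , _ , neg a≈ = inj₁ (ro a≈)
    ... | suc j , j≤2ℓ , a≋ with ℕₚ.m≤n⇒m<n∨m≡n j≤2ℓ
    ...   | inj₁ j<2ℓ = inj₂ (inj₂ (short-step j<2ℓ a≋))
    ...   | inj₂ refl = inj₂ (long a≋)
      where
      long : a ≋± 2ℓ → ro a ≋ ro (+ 2ℓ) ⊎ Step vertices (ro a)
      long (pos a≈) = inj₁ (ro a≈)
      long (neg a≈) = inj₂ (step≈ (enter-rotations (last-++ (alternate ro⁻ re⁺ 1 ℓ-1) refl))
        (ro (≈-trans (neg-even {i = ℓ} a≈) (- + 1 by eq L))))
        where
        eq : ∀ l → - (l + l) ≡ - - l + (l + + 1 + + 0) + - + 1 * (+ 4 * l + + 1)
        eq = solve-∀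

    reflection-step : ∀ a → Step vertices (re a)
    reflection-step a with absolute-residue a
    ... | j , j≤2ℓ , a≋ with parity j
    reflection-step a | _ , j≤ , neg a≈ | even i =
      step≈ (in-Z₁ (within re⁻ ro⁺ {j = i} (suc ℓ) z≤n (s≤s (half-≤ {i} j≤)))) (re (≈-≡ (neg-even {i = i} a≈) (eq (+ i))))
      where
      eq : ∀ i → - (i + i) ≡ - i - i
      eq = solve-∀
    reflection-step a | _ , j≤ , neg a≈ | odd i =
      step≈ (in-Z₁ (between re⁻ ro⁺ {j = i} (suc ℓ) z≤n (s≤s (half-< {i} j≤)))) (re (≈-≡ (neg-odd {i = i} a≈) (eq (+ i))))
      where
      eq : ∀ i → - (+ 1 + (i + i)) ≡ - i + - (+ 1 + i)
      eq = solve-∀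
    reflection-step a | _ , j≤ , pos a≈ | even zero =
      step≈ (in-Z₁ (within re⁻ ro⁺ (suc ℓ) z≤n (s≤s z≤n))) (re a≈)
    reflection-step a | _ , j≤ , pos a≈ | even i@(suc _) with ℕₚ.m≤n⇒m<n∨m≡n (half-≤ {i} j≤)
    ... | inj₁ i<ℓ = step≈ (in-Z₀ (++⁺ˡ (within ro⁻ re⁺ ℓ-1 (s≤s z≤n) i<ℓ))) (re (≈-≡ (pos-even {i = i} a≈) (eq (+ i))))
      where
      eq : ∀ i → i + i ≡ - - i + i
      eq = solve-∀
    ... | inj₂ refl = step≈ (leave-rotations refl) (re (≈-trans (pos-even {i = ℓ} a≈) (+ 1 by eq L)))
      where
      eq : ∀ l → l + l ≡ - (l + + 1 + l) + + 0 + + 1 * (+ 4 * l + + 1)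
      eq = solve-∀
    reflection-step a | _ , j≤ , pos a≈ | odd zero = step≈ (enter-reflections (last-alternate re⁻ ro⁺ 0 ℓ))
      (re (≈-≡ a≈ (≡.trans (eq L) (cong (λ n → - + n + (L + + 1 + + 0)) (≡.sym (ℕₚ.+-identityʳ ℓ))))))
      where
      eq : ∀ l → + 1 ≡ - l + (l + + 1 + + 0)
      eq = solve-∀
    reflection-step a | _ , j≤ , pos a≈ | odd i@(suc i-1) = step≈ edge (re (≈-≡ (pos-odd {i = i} a≈) (eq (+ i))))
      where
      eq : ∀ i → + 1 + (i + i) ≡ i - - (+ 1 + i)
      eq = solve-∀
      edge : Consecutive vertices (re⁺ i) (ro⁻ (suc i))
      edge with ℕₚ.m≤n⇒m<n∨m≡n (half-< {i} j≤)
      ... | inj₁ i+1<ℓ = in-Z₀ (++⁺ˡ (between ro⁻ re⁺ ℓ-1 (s≤s z≤n) i+1<ℓ))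
      -- The last passage leads into the extra rotation `ro⁻ ℓ`, which lies outside the alternation.
      ... | inj₂ refl  = in-Z₀ (junction (alternate ro⁻ re⁺ 1 i)
                           (≡.trans (last-alternate ro⁻ re⁺ 1 i-1) (cong (just ∘ re⁺) (ℕₚ.+-comm i-1 1))) refl)

    path : Path (ro (+ 2ℓ))
    path = record
      { vertices        = vertices
      ; length-vertices = ≡.trans length-vertices (≡.trans (cong₂ (λ p q → p ℕ.+ (2ℓ ℕ.+ (q ℕ.+ 2ℓ)))
                            (≡.trans (length-++ (alternate ro⁻ re⁺ 1 ℓ-1)) (cong (ℕ._+ 1) (length-alternate ro⁻ re⁺ 1 ℓ-1)))
                            (length-alternate re⁻ ro⁺ 0 (suc ℓ))) (eq ℓ-1))
      ; unvisited       = re⁺ ℓ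
      ; visits          = visit
      ; steps           = λ { (ro a) → rotation-step a ; (re a) → inj₂ (inj₂ (reflection-step a)) }
      }
      where
      eq : ∀ k → 2 ℕ.* k ℕ.+ 1 ℕ.+ (2 ℕ.* suc k ℕ.+ (2 ℕ.* suc (suc k) ℕ.+ 2 ℕ.* suc k)) ≡ suc (8 ℕ.* suc k)
      eq = ℕ-solve-∀

-- Cut copies: avoiding an odd power of `u`.

-- The path that avoids u^r, where ps and qs are the parts of the permutation
-- before and after the cut.
module OddRotation (s-1 t-1 : ℕ) where
  open ℤ-Operations

  s t : ℕ
  s = suc s-1
  t = suc t-1
  open UncutPaths (s ℕ.+ t) using (ℓ; pos-even; pos-odd; neg-even; neg-odd; half-≤; half-<; ≈-≡)
  open Construction ℓ
  open Paths ℓ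

  r : ℕ
  r = suc (2 ℕ.* s)

  -- Exponents of the reflection quotients: `β` has `-2, …, -2s`; `α₀` has `2s + 2, …, 2ℓ - 2`; `α₁`
  -- has `0, …, 2s`; `γ` has `-(2s + 3), …, -(2ℓ - 1)`; `end` has `2ℓ`. The joint of `β` and `α₀`
  -- gives the rotation `u^-r`, that of `α₁` and `γ` the exponent `-1`, that of `γ` and `end` the
  -- rotation `u^(-2ℓ)`; `end` also contains `u^(2ℓ)`. The exponents still missing, `±r`,
  -- `-(2s + 2)`, `2ℓ - 1` and `-2ℓ`, come from the joints with the cut copies and from the bridge.
  α₀ α₁ β γ C₀ C₁ end : List D
  β   = alternate re⁻ ro⁺ 1 s
  α₀  = alternate ro⁻ re⁺ (suc s) t
  α₁  = alternate ro⁻ re⁺ 0 (suc s)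
  γ   = alternate ro⁺ (re⁻ ∘ suc) (suc s) t
  end = re⁺ ℓ ∷ ro⁻ ℓ ∷ ro⁺ ℓ ∷ []
  C₀  = β ++ α₀
  C₁  = α₁ ++ γ ++ end

  data Range : ℕ → Set where
    low  : ∀ {j} → j ℕ.≤ s → Range j
    high : ∀ {j} → suc s ℕ.≤ j → j ℕ.< suc s ℕ.+ t → Range j
    top  : Range ℓ

  range : ∀ {j} → j ℕ.≤ ℓ → Range j
  range {j} j≤ℓ with j ℕₚ.≤? s
  ... | yes j≤s = low j≤s
  ... | no  j≰s with ℕₚ.m≤n⇒m<n∨m≡n j≤ℓ
  ...   | inj₁ j<ℓ  = high (ℕₚ.≰⇒> j≰s) j<ℓ
  ...   | inj₂ refl = top

  module Cut (ps qs : List ℕ)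
    (length≡ : length (ps ++ qs) ≡ 2ℓ)
    (first≡ : head ps ≡ just (2 ℕ.* s)) (last≡ : last qs ≡ just ℓ)
    (contains : ∀ {p} → p ℕ.< 2ℓ → p ∈ ps ++ qs)
    (differences : ∀ {c} → suc c ℕ.< 2ℓ → suc c ≢ r →
      ∃[ a ] ∃[ b ] ((Consecutive ps a b ⊎ Consecutive qs a b) × ∣ b - a ∣ ≡ suc c))
    where

    -- Running `qs` before `ps` turns the known endpoints `2s` and `ℓ` into inner joints, while the
    -- four cut ends become the ends of `X` and `Y`.
    X Y : List D
    X = map roᵉ qs ++ C₀ ++ map roᵉ ps
    Y = map reᵉ qs ++ C₁ ++ map reᵉ ps

    -- `vertices` will be `X ++ Y` or `Y ++ X`, and all but the step between the halves is the same
    -- for both orders. That step, `u^-r v`, enters as `bridge`.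
    module Joined (vertices : List D)
      (length-vertices : length vertices ≡ length X ℕ.+ length Y)
      (X-∈ : ∀ {d} → d ∈ X → d ∈ vertices) (Y-∈ : ∀ {d} → d ∈ Y → d ∈ vertices)
      (X-edge : ∀ {a b} → Consecutive X a b → Consecutive vertices a b)
      (Y-edge : ∀ {a b} → Consecutive Y a b → Consecutive vertices a b)
      (bridge : ∀ {a} → a ≈ - + r → Step vertices (re a))
      where

      C₀-∈ : ∀ {d} → d ∈ C₀ → d ∈ vertices
      C₀-∈ = X-∈ ∘ ∈-++⁺ʳ (map roᵉ qs) ∘ ∈-++⁺ˡ

      C₁-∈ : ∀ {d} → d ∈ C₁ → d ∈ vertices
      C₁-∈ = Y-∈ ∘ ∈-++⁺ʳ (map reᵉ qs) ∘ ∈-++⁺ˡ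

      C₀-edge : ∀ {a b} → Consecutive C₀ a b → Consecutive vertices a b
      C₀-edge = X-edge ∘ ++⁺ʳ (map roᵉ qs) ∘ ++⁺ˡ

      C₁-edge : ∀ {a b} → Consecutive C₁ a b → Consecutive vertices a b
      C₁-edge = Y-edge ∘ ++⁺ʳ (map reᵉ qs) ∘ ++⁺ˡ

      graceful-∈ : ∀ {p} → p ℕ.< 2ℓ → roᵉ p ∈ vertices × reᵉ p ∈ vertices
      graceful-∈ p<2ℓ with ∈-++⁻ ps (contains p<2ℓ)
      ... | inj₁ p∈ = X-∈ (∈-++⁺ʳ (map roᵉ qs) (∈-++⁺ʳ C₀ (∈-map⁺ roᵉ p∈))) , Y-∈ (∈-++⁺ʳ (map reᵉ qs) (∈-++⁺ʳ C₁ (∈-map⁺ reᵉ p∈)))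
      ... | inj₂ p∈ = X-∈ (∈-++⁺ˡ (∈-map⁺ roᵉ p∈)) , Y-∈ (∈-++⁺ˡ (∈-map⁺ reᵉ p∈))

      short-step : ∀ {a j} → suc j ℕ.< 2ℓ → suc j ≢ r → a ≋± suc j → Step vertices (ro a)
      short-step j<2ℓ j≢r a≋ with differences j<2ℓ j≢r
      ... | x , y , inj₁ c , e = GracefulSteps.step e (X-edge (++⁺ʳ (map roᵉ qs) (++⁺ʳ C₀ (map⁺ roᵉ c))))
                                   (Y-edge (++⁺ʳ (map reᵉ qs) (++⁺ʳ C₁ (map⁺ reᵉ c)))) a≋
      ... | x , y , inj₂ c , e = GracefulSteps.step e (X-edge (++⁺ˡ (map⁺ roᵉ c))) (Y-edge (++⁺ˡ (map⁺ reᵉ c))) a≋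

      visit : ∀ d → d ≋ re⁻ (suc s) ⊎ Visits vertices d
      visit (ro a) with position a
      ... | inj₂ (p , p<2ℓ , a≈) = inj₂ (_ , proj₁ (graceful-∈ p<2ℓ) , ro a≈)
      ... | inj₁ (j , j≤ℓ , a≋) with range j≤ℓ
      visit (ro a) | inj₁ (zero , _ , pos a≈) | _ = inj₂ (_ , C₁-∈ (here refl) , ro a≈)
      visit (ro a) | inj₁ (suc j , _ , pos a≈) | low j≤s = inj₂ (_ , C₀-∈ (∈-++⁺ˡ (∈-alternateʳ re⁻ ro⁺ s (s≤s z≤n) (s≤s j≤s))) , ro a≈)
      visit (ro a) | inj₁ (j@(suc _) , _ , pos a≈) | high s<j j<ℓ =
        inj₂ (_ , C₁-∈ (∈-++⁺ʳ α₁ (∈-++⁺ˡ (∈-alternateˡ ro⁺ (re⁻ ∘ suc) t s<j j<ℓ))) , ro a≈)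
      visit (ro a) | inj₁ (suc _ , _ , pos a≈) | top = inj₂ (_ , C₁-∈ (∈-++⁺ʳ α₁ (∈-++⁺ʳ γ (there (there (here refl))))) , ro a≈)
      visit (ro a) | inj₁ (j , _ , neg a≈) | low j≤s = inj₂ (_ , C₁-∈ (∈-++⁺ˡ (∈-alternateˡ ro⁻ re⁺ (suc s) z≤n (s≤s j≤s))) , ro a≈)
      visit (ro a) | inj₁ (j , _ , neg a≈) | high s<j j<ℓ = inj₂ (_ , C₀-∈ (∈-++⁺ʳ β (∈-alternateˡ ro⁻ re⁺ t s<j j<ℓ)) , ro a≈)
      visit (ro a) | inj₁ (j , _ , neg a≈) | top = inj₂ (_ , C₁-∈ (∈-++⁺ʳ α₁ (∈-++⁺ʳ γ (there (here refl)))) , ro a≈)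
      visit (re a) with position a
      ... | inj₂ (p , p<2ℓ , a≈) = inj₂ (_ , proj₂ (graceful-∈ p<2ℓ) , re a≈)
      ... | inj₁ (j , j≤ℓ , a≋) with range j≤ℓ
      visit (re a) | inj₁ (j , _ , pos a≈) | low j≤s = inj₂ (_ , C₁-∈ (∈-++⁺ˡ (∈-alternateʳ ro⁻ re⁺ (suc s) z≤n (s≤s j≤s))) , re a≈)
      visit (re a) | inj₁ (j , _ , pos a≈) | high s<j j<ℓ = inj₂ (_ , C₀-∈ (∈-++⁺ʳ β (∈-alternateʳ ro⁻ re⁺ t s<j j<ℓ)) , re a≈)
      visit (re a) | inj₁ (j , _ , pos a≈) | top = inj₂ (_ , C₁-∈ (∈-++⁺ʳ α₁ (∈-++⁺ʳ γ (here refl))) , re a≈)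
      visit (re a) | inj₁ (zero , _ , neg a≈) | _ = inj₂ (_ , C₁-∈ (there (here refl)) , re a≈)
      visit (re a) | inj₁ (suc j , _ , neg a≈) | low j≤s = inj₂ (_ , C₀-∈ (∈-++⁺ˡ (∈-alternateˡ re⁻ ro⁺ s (s≤s z≤n) (s≤s j≤s))) , re a≈)
      -- The reflections of `γ` sit one index further than its rotations, so they begin at
      -- `-(s + 2)`, and `-(s + 1)` stays unvisited.
      visit (re a) | inj₁ (suc j , j≤ℓ , neg a≈) | high (s≤s s≤j) _ = above (ℕₚ.m≤n⇒m<n∨m≡n s≤j)
        where
        above : s ℕ.< j ⊎ s ≡ j → re a ≋ re⁻ (suc s) ⊎ Visits vertices (re a)
        above (inj₁ s<j)  = inj₂ (_ , C₁-∈ (∈-++⁺ʳ α₁ (∈-++⁺ˡ (∈-alternateʳ ro⁺ (re⁻ ∘ suc) t s<j j≤ℓ))) , re a≈)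
        above (inj₂ refl) = inj₁ (re a≈)
      visit (re a) | inj₁ (suc j , j≤ℓ , neg a≈) | top = inj₂ (_ , C₁-∈ (∈-++⁺ʳ α₁ (∈-++⁺ˡ
        (∈-alternateʳ ro⁺ (re⁻ ∘ suc) t (ℕₚ.≤-trans (ℕₚ.≤-reflexive (ℕₚ.+-comm 1 s)) (ℕₚ.+-monoʳ-≤ s (s≤s z≤n))) ℕₚ.≤-refl))) , re a≈)

      last-γ : last γ ≡ just (re⁻ ℓ)
      last-γ = ≡.trans (last-alternate ro⁺ (re⁻ ∘ suc) (suc s) t-1) (cong (just ∘ re⁻ ∘ suc) (eq s t-1))
        where
        eq : ∀ s t → t ℕ.+ suc s ≡ s ℕ.+ suc t
        eq = ℕ-solve-∀

      last-α₀ : last α₀ ≡ just (re⁺ (s ℕ.+ t))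
      last-α₀ = ≡.trans (last-alternate ro⁻ re⁺ (suc s) t-1) (cong (just ∘ re⁺) (eq s t-1))
        where
        eq : ∀ s t → t ℕ.+ suc s ≡ s ℕ.+ suc t
        eq = ℕ-solve-∀

      last-β : last β ≡ just (ro⁺ s)
      last-β = ≡.trans (last-alternate re⁻ ro⁺ 1 s-1) (cong (just ∘ ro⁺) (ℕₚ.+-comm s-1 1))

      last-α₁ : last α₁ ≡ just (re⁺ s)
      last-α₁ = ≡.trans (last-alternate ro⁻ re⁺ 0 s) (cong (just ∘ re⁺) (ℕₚ.+-identityʳ s))

      enter-ro : ∀ {d} → last C₀ ≡ just d → Consecutive vertices d (roᵉ (2 ℕ.* s))
      enter-ro l = X-edge (++⁺ʳ (map roᵉ qs) (junction C₀ l (head-map roᵉ first≡)))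

      enter-re : Consecutive vertices (ro⁺ ℓ) (reᵉ (2 ℕ.* s))
      enter-re = Y-edge (++⁺ʳ (map reᵉ qs) (junction C₁ (last-++ α₁ (last-++ γ refl)) (head-map reᵉ first≡)))

      leave-ro : Consecutive vertices (roᵉ ℓ) (re⁻ 1)
      leave-ro = X-edge (junction (map roᵉ qs) (last-map roᵉ qs last≡) refl)

      leave-re : Consecutive vertices (reᵉ ℓ) (ro⁻ 0)
      leave-re = Y-edge (junction (map reᵉ qs) (last-map reᵉ qs last≡) refl)

      rotation-step : ∀ a → ro a ≋ ro (+ 0) ⊎ ro a ≋ ro (+ r) ⊎ Step vertices (ro a)
      rotation-step a with absolute-residue a
      ... | zero , _ , pos a≈ = inj₁ (ro a≈)
      ... | zero , _ , neg a≈ = inj₁ (ro a≈)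
      ... | suc j , j≤2ℓ , a≋ with suc j ℕₚ.≟ r
      rotation-step a | suc j , j≤2ℓ , pos a≈ | yes refl = inj₂ (inj₁ (ro a≈))
      -- Both copies lose their edge of difference `r`, and with it `u^r` and `u^-r`; the joint of
      -- `β` and `α₀` restores the latter.
      rotation-step a | suc j , j≤2ℓ , neg a≈ | yes refl =
        inj₂ (inj₂ (step≈ (C₀-edge (junction β last-β refl)) (ro (≈-≡ (neg-odd {i = s} a≈) (eq (+ s))))))
        where
        eq : ∀ s → - (+ 1 + (s + s)) ≡ - s + - (+ 1 + s)
        eq = solve-∀
      ... | no j≢r with ℕₚ.m≤n⇒m<n∨m≡n j≤2ℓ
      ...   | inj₁ j<2ℓ = inj₂ (inj₂ (short-step j<2ℓ j≢r a≋))
      ...   | inj₂ refl = inj₂ (inj₂ (long a≋))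
        where
        long : a ≋± 2ℓ → Step vertices (ro a)
        long (pos a≈) = step≈ (C₁-edge (++⁺ʳ α₁ (++⁺ʳ γ (there here)))) (ro (≈-≡ (pos-even {i = ℓ} a≈) (eq L)))
          where
          eq : ∀ l → l + l ≡ - - l + l
          eq = solve-∀
        long (neg a≈) = step≈ (C₁-edge (++⁺ʳ α₁ (junction γ last-γ refl))) (ro (≈-≡ (neg-even {i = ℓ} a≈) (eq L)))
          where
          eq : ∀ l → - (l + l) ≡ - l - l
          eq = solve-∀

      e-α : ∀ i → i + i ≡ - - i + i
      e-α = solve-∀
      e-α′ : ∀ i → + 1 + (i + i) ≡ i - - (+ 1 + i)
      e-α′ = solve-∀
      e-β : ∀ i → - (i + i) ≡ - i - i
      e-β = solve-∀
      e-β′ : ∀ i → - (+ 1 + (i + i)) ≡ - i + - (+ 1 + i)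
      e-β′ = solve-∀

      positive-even : ∀ {a} i → i ℕ.≤ ℓ → a ≈ + (2 ℕ.* i) → Step vertices (re a)
      positive-even i i≤ℓ a≈ with range i≤ℓ
      ... | low i≤s      = step≈ (C₁-edge (++⁺ˡ (within ro⁻ re⁺ (suc s) z≤n (s≤s i≤s)))) (re (≈-≡ (pos-even {i = i} a≈) (e-α (+ i))))
      ... | high s<i i<ℓ = step≈ (C₀-edge (++⁺ʳ β (within ro⁻ re⁺ t s<i i<ℓ))) (re (≈-≡ (pos-even {i = i} a≈) (e-α (+ i))))
      ... | top          = step≈ (C₁-edge (++⁺ʳ α₁ (++⁺ʳ γ here))) (re (≈-≡ (pos-even {i = ℓ} a≈) (eq L)))
        where
        eq : ∀ l → l + l ≡ l - - l
        eq = solve-∀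

      positive-odd : ∀ {a} i → i ℕ.< ℓ → a ≈ + suc (2 ℕ.* i) → Step vertices (re a)
      positive-odd i i<ℓ a≈ with range i<ℓ
      ... | low i<s = step≈ (C₁-edge (++⁺ˡ (between ro⁻ re⁺ (suc s) z≤n (s≤s i<s)))) (re (≈-≡ (pos-odd {i = i} a≈) (e-α′ (+ i))))
      -- From the exit `2ℓ + 1` to `-1` the exponent is `-(2ℓ + 2)`, which wraps to `2ℓ - 1`.
      ... | top     = step≈ leave-ro (re (≈-trans (pos-odd {i = i} a≈) (+ 1 by eq (+ s) (+ t))))
        where
        eq : ∀ s t → + 1 + ((s + t) + (s + t)) ≡ - ((+ 1 + (s + t)) + + 1 + (+ 1 + (s + t))) + - + 1 + + 1 * (+ 4 * (+ 1 + (s + t)) + + 1)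
        eq = solve-∀
      ... | high (s≤s s≤i) i+1<ℓ with ℕₚ.m≤n⇒m<n∨m≡n s≤i
      ...   | inj₁ s<i  = step≈ (C₀-edge (++⁺ʳ β (between ro⁻ re⁺ t s<i i+1<ℓ))) (re (≈-≡ (pos-odd {i = i} a≈) (e-α′ (+ i))))
      -- The starting value `2s` is chosen for this joint: from `u^ℓ` to the reflection at
      -- `ℓ + 1 + 2s` the exponent is `2s + 1 = r`.
      ...   | inj₂ refl = step≈ enter-re (re (≈-≡ a≈ (eq L (+ (2 ℕ.* s)))))
        where
        eq : ∀ l p → + 1 + p ≡ - l + (l + + 1 + p)
        eq = solve-∀

      negative-even : ∀ {a} i → i ℕ.≤ ℓ → a ≈ - + (2 ℕ.* i) → Step vertices (re a)
      negative-even zero    _   a≈ = positive-even 0 z≤n a≈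
      negative-even i@(suc i-1) i≤ℓ a≈ with range i≤ℓ
      ... | low i≤s = step≈ (C₀-edge (++⁺ˡ (within re⁻ ro⁺ s (s≤s z≤n) (s≤s i≤s)))) (re (≈-≡ (neg-even {i = i} a≈) (e-β (+ i))))
      ... | top     = step≈ leave-re (re (≈-trans (neg-even {i = ℓ} a≈) (- + 1 by eq L)))
        where
        eq : ∀ l → - (l + l) ≡ (l + + 1 + l) - + 0 + - + 1 * (+ 4 * l + + 1)
        eq = solve-∀
      ... | high (s≤s s≤i) i<ℓ with ℕₚ.m≤n⇒m<n∨m≡n s≤i
      ...   | inj₁ s<i  = step≈ (C₁-edge (++⁺ʳ α₁ (++⁺ˡ (between ro⁺ (re⁻ ∘ suc) t s<i i<ℓ)))) (re (≈-≡ (neg-even {i = i} a≈) (e-β (+ i))))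
      -- The same starting value gives `-(2s + 2)` when the rotation copy is entered from
      -- `u^(ℓ-1) v`.
      ...   | inj₂ refl = step≈ (enter-ro (last-++ β last-α₀)) (re (≈-≡ (neg-even {i = i} a≈) (≡.trans (eq (+ s) (+ t)) (cong (λ n → (+ s + + t) - (L + + 1 + n)) (cong +_ (cong (s ℕ.+_) (≡.sym (ℕₚ.+-identityʳ s))))))))
        where
        eq : ∀ s t → - ((+ 1 + s) + (+ 1 + s)) ≡ (s + t) - ((+ 1 + (s + t)) + + 1 + (s + s))
        eq = solve-∀

      negative-odd : ∀ {a} i → i ℕ.< ℓ → a ≈ - + suc (2 ℕ.* i) → Step vertices (re a)
      negative-odd zero    _   a≈ = step≈ (C₁-edge (junction α₁ last-α₁ refl)) (re (≈-≡ a≈ (eq (+ s))))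
        where
        eq : ∀ s → - + 1 ≡ s - (+ 1 + s)
        eq = solve-∀
      negative-odd i@(suc _) i<ℓ a≈ with range (ℕₚ.<⇒≤ i<ℓ)
      ... | high s<i i<ℓ′ = step≈ (C₁-edge (++⁺ʳ α₁ (++⁺ˡ (within ro⁺ (re⁻ ∘ suc) t s<i i<ℓ′)))) (re (≈-≡ (neg-odd {i = i} a≈) (e-β′ (+ i))))
      ... | top           = contradiction i<ℓ (ℕₚ.<-irrefl refl)
      ... | low i≤s with ℕₚ.m≤n⇒m<n∨m≡n i≤s
      ...   | inj₁ i<s  = step≈ (C₀-edge (++⁺ˡ (between re⁻ ro⁺ s (s≤s z≤n) (s≤s i<s)))) (re (≈-≡ (neg-odd {i = i} a≈) (e-β′ (+ i))))
      -- The one exponent, `-r`, that no zigzag and no inner joint provides.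
      ...   | inj₂ refl = bridge a≈

      reflection-step : ∀ a → Step vertices (re a)
      reflection-step a with absolute-residue a
      ... | j , j≤2ℓ , a≋ with parity j
      reflection-step a | _ , j≤ , pos a≈ | even i = positive-even i (half-≤ j≤) a≈
      reflection-step a | _ , j≤ , neg a≈ | even i = negative-even i (half-≤ j≤) a≈
      reflection-step a | _ , j≤ , pos a≈ | odd i  = positive-odd i (half-< j≤) a≈
      reflection-step a | _ , j≤ , neg a≈ | odd i  = negative-odd i (half-< j≤) a≈

      path : Path (ro (+ r))
      path = record
        { vertices        = vertices
        ; length-vertices = ≡.trans length-vertices total
        ; unvisited       = re⁻ (suc s)
        ; visits          = visit
        ; steps           = λ { (ro a) → rotation-step a ; (re a) → inj₂ (inj₂ (reflection-step a)) }
        }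
        where
        lengths : ∀ (f : ℕ → D) C → length (map f qs ++ C ++ map f ps) ≡ length C ℕ.+ 2ℓ
        lengths f C = ≡.trans (length-++ (map f qs)) (≡.trans (cong₂ ℕ._+_ (length-map f qs)
          (≡.trans (length-++ C) (cong (length C ℕ.+_) (length-map f ps))))
          (≡.trans (eq (length qs) (length C) (length ps)) (cong (length C ℕ.+_) (≡.trans (≡.sym (length-++ ps)) length≡))))
          where
          eq : ∀ q c p → q ℕ.+ (c ℕ.+ p) ≡ c ℕ.+ (p ℕ.+ q)
          eq = ℕ-solve-∀
        total : length X ℕ.+ length Y ≡ suc (8 ℕ.* ℓ)
        total = ≡.trans (cong₂ ℕ._+_
          (≡.trans (lengths roᵉ C₀) (cong (ℕ._+ 2ℓ) (≡.trans (length-++ β) (cong₂ ℕ._+_ (length-alternate re⁻ ro⁺ 1 s) (length-alternate ro⁻ re⁺ (suc s) t)))))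
          (≡.trans (lengths reᵉ C₁) (cong (ℕ._+ 2ℓ) (≡.trans (length-++ α₁) (cong₂ ℕ._+_ (length-alternate ro⁻ re⁺ 0 (suc s))
            (≡.trans (length-++ γ) (cong (ℕ._+ 3) (length-alternate ro⁺ (re⁻ ∘ suc) (suc s) t))))))))
          (eq s t)
          where
          eq : ∀ s t → 2 ℕ.* s ℕ.+ 2 ℕ.* t ℕ.+ 2 ℕ.* suc (s ℕ.+ t) ℕ.+ (2 ℕ.* suc s ℕ.+ (2 ℕ.* t ℕ.+ 3) ℕ.+ 2 ℕ.* suc (s ℕ.+ t)) ≡ suc (8 ℕ.* suc (s ℕ.+ t))
          eq = ℕ-solve-∀

    -- The order of the halves decides whether the connecting edge contributes
    -- b - a or a - b.
    joinedPath : ∀ {a b} → last ps ≡ just a → head qs ≡ just b → b ≡ a ℕ.+ r ⊎ a ≡ b ℕ.+ r → Path (ro (+ r))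
    joinedPath {a} lastₚ headₚ (inj₁ refl) = Joined.path (Y ++ X)
      (≡.trans (length-++ Y) (ℕₚ.+-comm (length Y) (length X))) (∈-++⁺ʳ Y) ∈-++⁺ˡ (++⁺ʳ Y) ++⁺ˡ
      (λ z≈ → step≈ (junction Y last-Y head-X) (re (≈-trans z≈ (≡⇒≈ (eq L (+ a) (+ r))))))
      where
      last-Y : last Y ≡ just (reᵉ a)
      last-Y = last-++ (map reᵉ qs) (last-++ C₁ (last-map reᵉ ps lastₚ))
      head-X : head X ≡ just (roᵉ (a ℕ.+ r))
      head-X = head-++ {xs = map roᵉ qs} (head-map roᵉ headₚ)
      eq : ∀ l a r → - r ≡ (l + + 1 + a) - (l + + 1 + (a + r))
      eq = solve-∀
    joinedPath {_} {b} lastₚ headₚ (inj₂ refl) = Joined.path (X ++ Y) (length-++ X)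
      ∈-++⁺ˡ (∈-++⁺ʳ X) ++⁺ˡ (++⁺ʳ X)
      (λ z≈ → step≈ (junction X last-X head-Y) (re (≈-trans z≈ (≡⇒≈ (eq L (+ b) (+ r))))))
      where
      last-X : last X ≡ just (roᵉ (b ℕ.+ r))
      last-X = last-++ (map roᵉ qs) (last-++ C₀ (last-map roᵉ ps lastₚ))
      head-Y : head Y ≡ just (reᵉ b)
      head-Y = head-++ {xs = map reᵉ qs} (head-map reᵉ headₚ)
      eq : ∀ l b r → - r ≡ - (l + + 1 + (b + r)) + (l + + 1 + b)
      eq = solve-∀

  module _ (g : Graceful 2ℓ (2 ℕ.* s) ℓ) where
    open Graceful g

    r<2ℓ : r ℕ.< 2ℓ
    r<2ℓ = ℕₚ.≤-trans (ℕₚ.m≤m+n (suc r) (2 ℕ.* t)) (ℕₚ.≤-reflexive (eq s t))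
      where
      eq : ∀ s t → suc (suc (2 ℕ.* s)) ℕ.+ 2 ℕ.* t ≡ 2 ℕ.* suc (s ℕ.+ t)
      eq = ℕ-solve-∀

    from-edge : ∃[ a ] ∃[ b ] (Consecutive elements a b × ∣ b - a ∣ ≡ r) → Path (ro (+ r))
    from-edge (a , b , edge , ∣b-a∣≡r) with split edge
    ... | ps , qs , elements≡ , lastₚ , headₚ = Cut.joinedPath ps qs
      (≡.trans (cong length (≡.sym elements≡)) length≡)
      (head-suffix lastₚ (≡.trans (cong head (≡.sym elements≡)) head≡))
      (last-prefix ps headₚ (≡.trans (cong last (≡.sym elements≡)) last≡))
      (λ p< → subst (_ ∈_) elements≡ (contains p<)) edge-outside
      lastₚ headₚ (distance a b ∣b-a∣≡r)
      where
      edge-outside : ∀ {c} → suc c ℕ.< 2ℓ → suc c ≢ r →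
        ∃[ x ] ∃[ y ] ((Consecutive ps x y ⊎ Consecutive qs x y) × ∣ y - x ∣ ≡ suc c)
      edge-outside c<2ℓ c≢r with differences c<2ℓ
      ... | x , y , e , ∣y-x∣≡c with ++⁻ ps (subst (λ l → Consecutive l x y) elements≡ e)
      ...   | inj₁ e′        = x , y , inj₁ e′ , ∣y-x∣≡c
      ...   | inj₂ (inj₁ e′) = x , y , inj₂ e′ , ∣y-x∣≡c
      -- An edge across the cut is the cut edge itself, whose difference is `r`.
      ...   | inj₂ (inj₂ (l , h)) with ≡.trans (≡.sym l) lastₚ | ≡.trans (≡.sym h) headₚ
      ...     | refl | refl = contradiction (≡.trans (≡.sym ∣y-x∣≡c) ∣b-a∣≡r) c≢r

    oddRotationPath : Path (ro (+ r))
    oddRotationPath = from-edge (differences r<2ℓ)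

-- For ℓ = 2 and r = 3 no endpoints are admissible; this path was found by search.
module NineRotations where
  open Paths 2

  vertices : List D
  vertices = ro (+ 0) ∷ ro (+ 1) ∷ ro (+ 3) ∷ ro (+ 2) ∷ ro (+ 6) ∷ re (+ 0) ∷ ro (+ 4) ∷ re (+ 1) ∷ ro (+ 8) ∷
             re (+ 7) ∷ ro (+ 7) ∷ re (+ 2) ∷ re (+ 6) ∷ ro (+ 5) ∷ re (+ 3) ∷ re (+ 5) ∷ re (+ 8) ∷ []

  private
    Visited Stepped : D → Set
    Visited d = d ≋ re (+ 4) ⊎ Any (d ≋_) vertices
    Stepped d = d ≋ ro (+ 0) ⊎ d ≋ ro (+ 3) ⊎ Any (d ≋_) (labels vertices)

    visited? : ∀ d → Dec (Visited d)
    visited? d = (d ≋? re (+ 4)) ⊎-dec any? (d ≋?_) vertices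

    stepped? : ∀ d → Dec (Stepped d)
    stepped? d = (d ≋? ro (+ 0)) ⊎-dec ((d ≋? ro (+ 3)) ⊎-dec any? (d ≋?_) (labels vertices))

    representative : D → D
    representative (ro a) = ro (+ residue a)
    representative (re a) = re (+ residue a)

    everywhere : ∀ {P : D → Set} → (∀ (i : Fin 9) → P (ro (+ toℕ i))) → (∀ (i : Fin 9) → P (re (+ toℕ i))) → ∀ d → P (representative d)
    everywhere {P} rotations reflections (ro a) = subst (λ k → P (ro (+ k))) (Finₚ.toℕ-fromℕ< (residue<m a)) (rotations (fromℕ< (residue<m a)))
    everywhere {P} rotations reflections (re a) = subst (λ k → P (re (+ k))) (Finₚ.toℕ-fromℕ< (residue<m a)) (reflections (fromℕ< (residue<m a)))

    ≋representative : ∀ d → d ≋ representative d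
    ≋representative (ro a) = ro (≈residue a)
    ≋representative (re a) = re (≈residue a)

  path : Path (ro (+ 3))
  path = record
    { vertices        = vertices
    ; length-vertices = refl
    ; unvisited       = re (+ 4)
    ; visits          = λ d → visit d (everywhere {Visited} (toWitness {a? = Finₚ.all? (λ i → visited? (ro (+ toℕ i)))} tt)
                                                  (toWitness {a? = Finₚ.all? (λ i → visited? (re (+ toℕ i)))} tt) d)
    ; steps           = λ d → step d (everywhere {Stepped} (toWitness {a? = Finₚ.all? (λ i → stepped? (ro (+ toℕ i)))} tt)
                                                 (toWitness {a? = Finₚ.all? (λ i → stepped? (re (+ toℕ i)))} tt) d)
    }
    where
    visit : ∀ d → Visited (representative d) → d ≋ re (+ 4) ⊎ Visits vertices d
    visit d (inj₁ p) = inj₁ (≋-trans (≋representative d) p)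
    visit d (inj₂ q) with find q
    ... | x , x∈ , p = inj₂ (x , x∈ , ≋-trans (≋representative d) p)
    step : ∀ d → Stepped (representative d) → d ≋ ro (+ 0) ⊎ d ≋ ro (+ 3) ⊎ Step vertices d
    step d (inj₁ p)        = inj₁ (≋-trans (≋representative d) p)
    step d (inj₂ (inj₁ p)) = inj₂ (inj₁ (≋-trans (≋representative d) p))
    step d (inj₂ (inj₂ q)) with Any⇒Step vertices q
    ... | x , y , c , p = inj₂ (inj₂ (x , y , c , ≋-trans (≋representative d) p))

-- Admissible endpoints and reduction to the constructed paths.

module FromConjecture (conjecture : GvözdjakConjecture) where
  open ℤ-Operations

  gracefulPermutation : ∀ n x y → 0 ℕ.< n → x ≢ y → x ℕ.≤ n ℕ.∸ 1 → y ℕ.≤ n ℕ.∸ 1 →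
    ∣ x - y ∣ % 2 ≡ ⌊ n /2⌋ % 2 → 2 ℕ.* ∣ x - y ∣ ℕ.≤ n →
    n ℕ.∸ 1 ℕ.≤ 2 ℕ.* (x ℕ.+ y) → 2 ℕ.* (x ℕ.+ y) ℕ.≤ 3 ℕ.* n ℕ.∸ 3 → Graceful n x y
  gracefulPermutation n x y a b c d e f g h with conjecture n x y a b c d e f g h
  ... | _ , is-graceful , h≡ , l≡ = graceful is-graceful h≡ l≡

  half-double : ∀ ℓ → ⌊ 2 ℕ.* ℓ /2⌋ ≡ ℓ
  half-double ℓ = ≡.trans (cong ⌊_/2⌋ (cong (ℓ ℕ.+_) (ℕₚ.+-identityʳ ℓ))) (≡.sym (ℕₚ.n≡⌊n+n/2⌋ ℓ))

  -- For `n = 2ℓ` the difference of `0` and `ℓ` is exactly `n / 2`, the largest allowed, which also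
  -- settles the parity; twice their sum, `2ℓ`, lies between `2ℓ - 1` and `6ℓ - 3`.
  graceful-from-0 : ∀ k → Graceful (2 ℕ.* suc k) 0 (suc k)
  graceful-from-0 k = gracefulPermutation (2 ℕ.* suc k) 0 (suc k) (s≤s z≤n) (λ ()) z≤n
    (ℕₚ.≤-trans (ℕₚ.m≤n+m (suc k) k) (ℕₚ.≤-reflexive (eq₁ k)))
    (cong (_% 2) (≡.sym (half-double (suc k)))) ℕₚ.≤-refl (ℕₚ.m∸n≤m (2 ℕ.* suc k) 1)
    (ℕₚ.m+n≤o⇒m≤o∸n (2 ℕ.* suc k) (ℕₚ.≤-trans (ℕₚ.m≤m+n _ (suc (4 ℕ.* k))) (ℕₚ.≤-reflexive (eq₂ k))))
    where
    eq₁ : ∀ k → k ℕ.+ suc k ≡ k ℕ.+ (suc k ℕ.+ 0)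
    eq₁ = ℕ-solve-∀
    eq₂ : ∀ k → 2 ℕ.* suc k ℕ.+ 3 ℕ.+ suc (4 ℕ.* k) ≡ 3 ℕ.* (2 ℕ.* suc k)
    eq₂ = ℕ-solve-∀

  module _ (s-1 t-1 : ℕ) where
    open OddRotation s-1 t-1

    private
      ℓ : ℕ
      ℓ = suc (s ℕ.+ t)

      -- `2s` is even and lies between `0` and `2ℓ`. When `2s = ℓ + d`, the parity is read off
      -- `d + 2ℓ = ℓ + 2s`.
      difference-bounded : ∀ {d} → d ≡ ∣ 2 ℕ.* s - ℓ ∣ → d ℕ.≤ ℓ × d % 2 ≡ ℓ % 2
      difference-bounded {d} eq with distance ℓ (2 ℕ.* s) (≡.sym eq)
      ... | inj₁ 2s≡ℓ+d = ℕₚ.+-cancelˡ-≤ ℓ d ℓ (ℕₚ.≤-trans (ℕₚ.≤-reflexive (≡.sym 2s≡ℓ+d))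
                            (ℕₚ.≤-trans (ℕₚ.m≤m+n _ (suc (suc (2 ℕ.* t)))) (ℕₚ.≤-reflexive (eq₁ s t))))
        , ≡.trans (≡.sym ([m+kn]%n≡m%n d ℓ 2)) (≡.trans (cong (_% 2) (≡.trans (eq₂ d ℓ) (≡.trans (cong (ℓ ℕ.+_) (≡.sym 2s≡ℓ+d)) (cong (ℓ ℕ.+_) (ℕₚ.*-comm 2 s)))))
                    ([m+kn]%n≡m%n ℓ s 2))
        where
        eq₁ : ∀ s t → 2 ℕ.* s ℕ.+ suc (suc (2 ℕ.* t)) ≡ suc (s ℕ.+ t) ℕ.+ suc (s ℕ.+ t)
        eq₁ = ℕ-solve-∀
        eq₂ : ∀ d l → d ℕ.+ l ℕ.* 2 ≡ l ℕ.+ (l ℕ.+ d)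
        eq₂ = ℕ-solve-∀
      ... | inj₂ ℓ≡2s+d = ℕₚ.≤-trans (ℕₚ.m≤n+m d (2 ℕ.* s)) (ℕₚ.≤-reflexive (≡.sym ℓ≡2s+d))
        , ≡.trans (≡.sym ([m+kn]%n≡m%n d s 2)) (cong (_% 2) (≡.trans (eq₁ d s) (≡.sym ℓ≡2s+d)))
        where
        eq₁ : ∀ d s → d ℕ.+ s ℕ.* 2 ≡ 2 ℕ.* s ℕ.+ d
        eq₁ = ℕ-solve-∀

    -- The upper bound `2(2s + ℓ) ≤ 6ℓ - 3` amounts to `s < ℓ`, which `ℓ = s + t + 1` provides; for
    -- the lower bound the summand `ℓ` suffices.
    graceful-from-2s : 2 ℕ.* s ≢ ℓ → Graceful (2 ℕ.* ℓ) (2 ℕ.* s) ℓ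
    graceful-from-2s 2s≢ℓ = gracefulPermutation (2 ℕ.* ℓ) (2 ℕ.* s) ℓ (s≤s z≤n) 2s≢ℓ
      (ℕₚ.≤-trans (ℕₚ.m≤m+n (2 ℕ.* s) (suc (2 ℕ.* t))) (ℕₚ.≤-reflexive (eq₁ s t)))
      (ℕₚ.≤-trans (ℕₚ.m≤n+m ℓ (s ℕ.+ t)) (ℕₚ.≤-reflexive (cong ((s ℕ.+ t) ℕ.+_) (≡.sym (ℕₚ.+-identityʳ ℓ)))))
      (≡.trans (proj₂ (difference-bounded refl)) (cong (_% 2) (≡.sym (half-double ℓ))))
      (ℕₚ.*-monoʳ-≤ 2 (proj₁ (difference-bounded refl)))
      (ℕₚ.≤-trans (ℕₚ.m∸n≤m (2 ℕ.* ℓ) 1) (ℕₚ.*-monoʳ-≤ 2 (ℕₚ.m≤n+m ℓ (2 ℕ.* s))))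
      (ℕₚ.m+n≤o⇒m≤o∸n (2 ℕ.* (2 ℕ.* s ℕ.+ ℓ)) (ℕₚ.≤-trans (ℕₚ.m≤m+n _ (suc (4 ℕ.* t-1 ℕ.+ 4))) (ℕₚ.≤-reflexive (eq₂ s t-1))))
      where
      eq₁ : ∀ s t → 2 ℕ.* s ℕ.+ suc (2 ℕ.* t) ≡ s ℕ.+ t ℕ.+ (suc (s ℕ.+ t) ℕ.+ 0)
      eq₁ = ℕ-solve-∀
      eq₂ : ∀ s t → 2 ℕ.* (2 ℕ.* s ℕ.+ suc (s ℕ.+ suc t)) ℕ.+ 3 ℕ.+ suc (4 ℕ.* t ℕ.+ 4) ≡ 3 ℕ.* (2 ℕ.* suc (s ℕ.+ suc t))
      eq₂ = ℕ-solve-∀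

  module _ (ℓ : ℕ) where
    open Paths ℓ

    oddPath : ∀ s → 1 ℕ.≤ s → suc s ℕ.< ℓ → 2 ℕ.* s ≢ ℓ → Path (ro (+ suc (2 ℕ.* s)))
    oddPath (suc s-1) _ s+1<ℓ 2s≢ℓ with ℕₚ.m≤n⇒∃[o]m+o≡n s+1<ℓ
    ... | t-1 , refl = subst (λ l → Paths.Path l (ro (+ suc (2 ℕ.* suc s-1)))) (eq s-1 t-1)
                         (OddRotation.oddRotationPath s-1 t-1 (graceful-from-2s s-1 t-1 (λ p → 2s≢ℓ (≡.trans p (eq s-1 t-1)))))
      where
      eq : ∀ s t → suc (suc s ℕ.+ suc t) ≡ suc (suc (suc s)) ℕ.+ t
      eq = ℕ-solve-∀

    -- `-2 · 2ℓ = 1 - m`, so doubling and negating takes the exception `u^(2ℓ)` to `u`.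
    unitPath : 0 ℕ.< ℓ → Path (ro (+ 1))
    unitPath (s≤s {n = k} _) = resp (ro (- + 1 by eq (+ suc k)))
      (negatePath (doublePath (UncutPaths.LargestRotationPath.path k (graceful-from-0 k))))
      where
      eq : ∀ l → - (+ 2 * (l + (l + + 0))) ≡ + 1 + - + 1 * (+ 4 * l + + 1)
      eq = solve-∀

    path-3 : 2 ℕ.< ℓ → Path (ro (+ 3))
    path-3 2<ℓ = oddPath 1 (s≤s z≤n) 2<ℓ (ℕₚ.<⇒≢ 2<ℓ)

    -- Strong induction: an even exponent comes from its half by doubling, and an odd one `2i + 1`
    -- from the cut construction, except when `i = 0`, `i = ℓ - 1` or `2i = ℓ`.
    rotationPath : 0 ℕ.< ℓ → ∀ c → 0 ℕ.< c → c ℕ.≤ 2 ℕ.* ℓ → Path (ro (+ c))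
    rotationPath 0<ℓ = <-rec _ step
      where
      step : ∀ c → (∀ {c′} → c′ ℕ.< c → 0 ℕ.< c′ → c′ ℕ.≤ 2 ℕ.* ℓ → Path (ro (+ c′))) → 0 ℕ.< c → c ℕ.≤ 2 ℕ.* ℓ → Path (ro (+ c))
      step c rec 0<c c≤2ℓ with parity c
      step _ rec () _ | even zero
      step _ rec 0<c c≤2ℓ | even i@(suc _) = resp (ro (≡⇒≈ (≡.sym (ℤₚ.pos-* 2 i))))
        (doublePath (rec i<2i (s≤s z≤n) (ℕₚ.≤-trans (ℕₚ.<⇒≤ i<2i) c≤2ℓ)))
        where
        i<2i : i ℕ.< 2 ℕ.* i
        i<2i = ℕₚ.m<m+n i (s≤s z≤n)
      step _ rec _ _ | odd zero = unitPath 0<ℓ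
      step _ rec _ c≤2ℓ | odd i@(suc _) with ℕₚ.m≤n⇒m<n∨m≡n (ℕₚ.*-cancelˡ-< 2 i ℓ c≤2ℓ)
      -- Here `ℓ = 2` and the exponent is already `3`: doubling and negating would only return `3`
      -- modulo `9`.
      step _ rec _ _ | odd 1 | inj₂ refl = NineRotations.path
      -- With `i = ℓ - 1`, twice the exponent is `4ℓ - 2`, which is `-3` modulo `m`.
      step _ rec _ _ | odd i@(suc (suc _)) | inj₂ refl =
        halvePath (resp (ro (- + 1 by ≡.trans (eq (+ i)) (cong (λ n → + 2 * (+ 1 + n) + - + 1 * M) (≡.sym (ℤₚ.pos-* 2 i)))))
          (negatePath (path-3 (s≤s (s≤s (s≤s z≤n))))))
        where
        eq : ∀ i → - + 3 ≡ + 2 * (+ 1 + + 2 * i) + - + 1 * (+ 4 * (+ 1 + i) + + 1)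
        eq = solve-∀
      ... | inj₁ i+1<ℓ with 2 ℕ.* i ℕₚ.≟ ℓ
      ...   | no 2i≢ℓ = oddPath i (s≤s z≤n) i+1<ℓ 2i≢ℓ
      -- With `2i = ℓ`, four times the exponent is `4ℓ + 4`, which is `3` modulo `m`.
      ...   | yes refl = halvePath (halvePath (resp
                (ro (- + 1 by ≡.trans (eq (+ i)) (cong (λ n → + 2 * (+ 2 * (+ 1 + n)) + - + 1 * (+ 4 * n + + 1)) (≡.sym (ℤₚ.pos-* 2 i)))))
                (path-3 (ℕₚ.≤-<-trans (s≤s (s≤s z≤n)) i+1<ℓ))))
        where
        eq : ∀ i → + 3 ≡ + 2 * (+ 2 * (+ 1 + + 2 * i)) + - + 1 * (+ 4 * (+ 2 * i) + + 1)
        eq = solve-∀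

    everyPath : 0 ℕ.< ℓ → ∀ e → ¬ e ≋ ro (+ 0) → Path e
    everyPath (s≤s {n = k} _) (re a) _ = translatePath a (UncutPaths.ReflectionPath.path k (graceful-from-0 k))
    everyPath 0<ℓ (ro a) a≉0 with absolute-residue a
    ... | zero  , _    , pos a≈ = contradiction (ro a≈) a≉0
    ... | zero  , _    , neg a≈ = contradiction (ro a≈) a≉0
    ... | suc c , c≤2ℓ , pos a≈ = resp (ro (≈-sym a≈)) (rotationPath 0<ℓ (suc c) (s≤s z≤n) c≤2ℓ)
    ... | suc c , c≤2ℓ , neg a≈ = resp (ro (≈-sym a≈)) (negatePath (rotationPath 0<ℓ (suc c) (s≤s z≤n) c≤2ℓ))

open import Defs

-- The presented group and its model by exponents.

module DihedralGroup (ℓ : ℕ) where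
  open ℤ-Operations

  open Paths ℓ

  W : Set
  W = Term DihedralGenerator

  infix 4 _≃_
  _≃_ : W → W → Set
  _≃_ = Group._≈_ (Dihedral m)

  infixl 7 _·_
  _·_ : D → D → D
  ro a · ro b = ro (a + b)
  ro a · re b = re (a + b)
  re a · ro b = re (a - b)
  re a · re b = ro (a - b)

  inv : D → D
  inv (ro a) = ro (- a)
  inv (re a) = re a

  eval : W → D
  eval (gen u)  = ro (+ 1)
  eval (gen v)  = re (+ 0)
  eval ε        = ro (+ 0)
  eval (x ∙ y)  = eval x · eval y
  eval (x ⁻¹)   = inv (eval x)

  ·-cong : ∀ {d d′ e e′} → d ≋ d′ → e ≋ e′ → d · e ≋ d′ · e′
  ·-cong (ro p) (ro q) = ro (+-cong-≈ p q)
  ·-cong (ro p) (re q) = re (+-cong-≈ p q)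
  ·-cong (re p) (ro q) = re (+-cong-≈ p (neg-cong-≈ q))
  ·-cong (re p) (re q) = ro (+-cong-≈ p (neg-cong-≈ q))

  inv-cong : ∀ {d e} → d ≋ e → inv d ≋ inv e
  inv-cong (ro p) = ro (neg-cong-≈ p)
  inv-cong (re p) = re p

  private
    +-assoc′ : ∀ a b c → a + b - c ≡ a + (b - c)
    +-assoc′ = solve-∀
    minus-assoc : ∀ a b c → a - b - c ≡ a - (b + c)
    minus-assoc = solve-∀
    minus-assoc′ : ∀ a b c → a - b + c ≡ a - (b - c)
    minus-assoc′ = solve-∀

  ·-assoc : ∀ d e f → (d · e) · f ≡ d · (e · f)
  ·-assoc (ro a) (ro b) (ro c) = cong ro (ℤₚ.+-assoc a b c)
  ·-assoc (ro a) (ro b) (re c) = cong re (ℤₚ.+-assoc a b c)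
  ·-assoc (ro a) (re b) (ro c) = cong re (+-assoc′ a b c)
  ·-assoc (ro a) (re b) (re c) = cong ro (+-assoc′ a b c)
  ·-assoc (re a) (ro b) (ro c) = cong re (minus-assoc a b c)
  ·-assoc (re a) (ro b) (re c) = cong ro (minus-assoc a b c)
  ·-assoc (re a) (re b) (ro c) = cong ro (minus-assoc′ a b c)
  ·-assoc (re a) (re b) (re c) = cong re (minus-assoc′ a b c)

  ·-identityˡ : ∀ d → ro (+ 0) · d ≡ d
  ·-identityˡ (ro a) = cong ro (ℤₚ.+-identityˡ a)
  ·-identityˡ (re a) = cong re (ℤₚ.+-identityˡ a)

  ·-identityʳ : ∀ d → d · ro (+ 0) ≡ d
  ·-identityʳ (ro a) = cong ro (ℤₚ.+-identityʳ a)
  ·-identityʳ (re a) = cong re (ℤₚ.+-identityʳ a)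

  inv-· : ∀ d → inv d · d ≡ ro (+ 0)
  inv-· (ro a) = cong ro (ℤₚ.+-inverseˡ a)
  inv-· (re a) = cong ro (ℤₚ.+-inverseʳ a)

  ·-inv : ∀ d → d · inv d ≡ ro (+ 0)
  ·-inv (ro a) = cong ro (ℤₚ.+-inverseʳ a)
  ·-inv (re a) = cong ro (ℤₚ.+-inverseʳ a)

  \\-def : ∀ d e → inv d · e ≡ d \\ e
  \\-def (ro _) (ro _) = refl
  \\-def (ro _) (re _) = refl
  \\-def (re _) (ro _) = refl
  \\-def (re _) (re _) = refl

  cancel-\\ : ∀ a d e → (a · d) · (d \\ e) ≡ a · e
  cancel-\\ a d e = begin
    (a · d) · (d \\ e)      ≡⟨ cong ((a · d) ·_) (\\-def d e) ⟨
    (a · d) · (inv d · e)   ≡⟨ ·-assoc a d (inv d · e) ⟩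
    a · (d · (inv d · e))   ≡⟨ cong (a ·_) (·-assoc d (inv d) e) ⟨
    a · ((d · inv d) · e)   ≡⟨ cong (λ z → a · (z · e)) (·-inv d) ⟩
    a · (ro (+ 0) · e)      ≡⟨ cong (a ·_) (·-identityˡ e) ⟩
    a · e                   ∎
    where open ≡.≡-Reasoning

  ·-cancelˡ : ∀ a {d e} → a · d ≋ a · e → d ≋ e
  ·-cancelˡ a {d} {e} p = ≋-trans (≡⇒≋ (≡.sym (undo d))) (≋-trans (·-cong ≋-refl p) (≡⇒≋ (undo e)))
    where
    undo : ∀ d → inv a · (a · d) ≡ d
    undo d = ≡.trans (≡.sym (·-assoc (inv a) a d)) (≡.trans (cong (_· d) (inv-· a)) (·-identityˡ d))

  eval-u^ : ∀ n → eval (gen u ^ n) ≡ ro (+ n)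
  eval-u^ zero    = refl
  eval-u^ (suc n) = cong (ro (+ 1) ·_) (eval-u^ n)

  -- The relation for `u^m` holds since `m` wraps to `0`, and that for `vu` since `-1` wraps to
  -- `m - 1`. Hence words with different values are different in the group.
  sound : ∀ {x y} → x ≃ y → eval x ≋ eval y
  sound (relation u^m≈ε)      = ≋-trans (≡⇒≋ (eval-u^ m)) (ro (+ 1 by ≡.trans (≡.sym M≡m) (eq M)))
    where
    eq : ∀ n → n ≡ + 0 + + 1 * n
    eq = solve-∀
  sound (relation v^2≈ε)      = ≋-refl
  sound (relation vu≈u^m-1∙v) = ≋-trans (re (- + 1 by eq)) (≡⇒≋ (cong (_· re (+ 0)) (≡.sym (eval-u^ (m ℕ.∸ 1)))))
    where
    open ≡.≡-Reasoning
    eq : + 0 - + 1 ≡ + (m ℕ.∸ 1) + + 0 + - + 1 * M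
    eq = begin
      + 0 - + 1                               ≡⟨ eq′ (+ 4 * L) ⟩
      + 4 * L + + 0 + - + 1 * M               ≡⟨ cong (λ n → n + + 0 + - + 1 * M) (ℤₚ.pos-* 4 ℓ) ⟨
      + (4 ℕ.* ℓ) + + 0 + - + 1 * M           ≡⟨ cong (λ n → + n + + 0 + - + 1 * M) (ℕₚ.m+n∸n≡m (4 ℕ.* ℓ) 1) ⟨
      + (m ℕ.∸ 1) + + 0 + - + 1 * M           ∎
      where
      eq′ : ∀ x → + 0 - + 1 ≡ x + + 0 + - + 1 * (x + + 1)
      eq′ = solve-∀
  sound refl             = ≋-refl
  sound (sym p)          = ≋-sym (sound p)
  sound (trans p q)      = ≋-trans (sound p) (sound q)
  sound (∙-cong p q)     = ·-cong (sound p) (sound q)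
  sound (⁻¹-cong p)      = inv-cong (sound p)
  sound (assoc x y z)    = ≡⇒≋ (·-assoc (eval x) (eval y) (eval z))
  sound (identityˡ x)    = ≡⇒≋ (·-identityˡ (eval x))
  sound (identityʳ x)    = ≡⇒≋ (·-identityʳ (eval x))
  sound (inverseˡ x)     = ≡⇒≋ (inv-· (eval x))
  sound (inverseʳ x)     = ≡⇒≋ (·-inv (eval x))

  open GroupProperties (Dihedral m) using (inverseˡ-unique)

  ^-+ : ∀ x i j → x ^ (i ℕ.+ j) ≃ x ^ i ∙ x ^ j
  ^-+ x zero    j = sym (identityˡ _)
  ^-+ x (suc i) j = trans (∙-cong refl (^-+ x i j)) (sym (assoc x (x ^ i) (x ^ j)))

  u^[k*m] : ∀ k → gen u ^ (k ℕ.* m) ≃ ε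
  u^[k*m] zero    = refl
  u^[k*m] (suc k) = trans (^-+ (gen u) m (k ℕ.* m)) (trans (∙-cong (relation u^m≈ε) (u^[k*m] k)) (identityˡ ε))

  v∙v : gen v ∙ gen v ≃ ε
  v∙v = trans (∙-cong refl (sym (identityʳ (gen v)))) (relation v^2≈ε)

  -- The power `u^(m-1)` plays the part of `u⁻¹`, so all exponents stay natural numbers.
  v∙u^ : ∀ n → gen v ∙ gen u ^ n ≃ gen u ^ (n ℕ.* (m ℕ.∸ 1)) ∙ gen v
  v∙u^ zero    = trans (identityʳ (gen v)) (sym (identityˡ (gen v)))
  v∙u^ (suc n) = begin
    gen v ∙ (gen u ∙ gen u ^ n)                        ≈⟨ assoc (gen v) (gen u) (gen u ^ n) ⟨
    (gen v ∙ gen u) ∙ gen u ^ n                        ≈⟨ ∙-cong (relation vu≈u^m-1∙v) refl ⟩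
    (gen u ^ (m ℕ.∸ 1) ∙ gen v) ∙ gen u ^ n            ≈⟨ assoc _ (gen v) (gen u ^ n) ⟩
    gen u ^ (m ℕ.∸ 1) ∙ (gen v ∙ gen u ^ n)            ≈⟨ ∙-cong refl (v∙u^ n) ⟩
    gen u ^ (m ℕ.∸ 1) ∙ (gen u ^ k ∙ gen v)            ≈⟨ assoc _ _ (gen v) ⟨
    (gen u ^ (m ℕ.∸ 1) ∙ gen u ^ k) ∙ gen v            ≈⟨ ∙-cong (^-+ (gen u) (m ℕ.∸ 1) k) refl ⟨
    gen u ^ (m ℕ.∸ 1 ℕ.+ k) ∙ gen v                    ∎
    where
    k = n ℕ.* (m ℕ.∸ 1)
    open SetoidReasoning (Group.setoid (Dihedral m))

  u^-inverse : ∀ n → gen u ^ n ∙ gen u ^ (n ℕ.* (m ℕ.∸ 1)) ≃ ε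
  u^-inverse n = trans (sym (^-+ (gen u) n _)) (subst (λ i → gen u ^ i ≃ ε) (eq n (4 ℕ.* ℓ)) (u^[k*m] n))
    where
    eq : ∀ n k → n ℕ.* (k ℕ.+ 1) ≡ n ℕ.+ n ℕ.* (k ℕ.+ 1 ℕ.∸ 1)
    eq n k = ≡.trans (eq′ n k) (cong (λ i → n ℕ.+ n ℕ.* i) (≡.sym (ℕₚ.m+n∸n≡m k 1)))
      where
      eq′ : ∀ n k → n ℕ.* (k ℕ.+ 1) ≡ n ℕ.+ n ℕ.* k
      eq′ = ℕ-solve-∀

  data Normal (x : W) : Set where
    rotation   : ∀ n → x ≃ gen u ^ n → Normal x
    reflection : ∀ n → x ≃ gen u ^ n ∙ gen v → Normal x

  -- Induction on the word: each `v` is moved to the right past the powers of `u`. The inverse of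
  -- `u^n` is `u^(n(m-1))`, while `u^n v` is its own inverse.
  normal : ∀ x → Normal x
  normal (gen u) = rotation 1 (sym (identityʳ (gen u)))
  normal (gen v) = reflection 0 (sym (identityˡ (gen v)))
  normal ε       = rotation 0 refl
  normal (x ∙ y) with normal x | normal y
  ... | rotation i p | rotation j q = rotation (i ℕ.+ j) (trans (∙-cong p q) (sym (^-+ (gen u) i j)))
  ... | rotation i p | reflection j q = reflection (i ℕ.+ j)
    (trans (∙-cong p q) (trans (sym (assoc _ _ _)) (∙-cong (sym (^-+ (gen u) i j)) refl)))
  ... | reflection i p | rotation j q = reflection (i ℕ.+ j ℕ.* (m ℕ.∸ 1))
    (trans (∙-cong p q) (trans (assoc _ _ _) (trans (∙-cong refl (v∙u^ j)) (trans (sym (assoc _ _ _)) (∙-cong (sym (^-+ (gen u) i _)) refl)))))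
  ... | reflection i p | reflection j q = rotation (i ℕ.+ j ℕ.* (m ℕ.∸ 1)) (begin
    x ∙ y                                           ≈⟨ ∙-cong p q ⟩
    (gen u ^ i ∙ gen v) ∙ (gen u ^ j ∙ gen v)       ≈⟨ assoc _ _ _ ⟩
    gen u ^ i ∙ (gen v ∙ (gen u ^ j ∙ gen v))       ≈⟨ ∙-cong refl (assoc _ _ _) ⟨
    gen u ^ i ∙ ((gen v ∙ gen u ^ j) ∙ gen v)       ≈⟨ ∙-cong refl (∙-cong (v∙u^ j) refl) ⟩
    gen u ^ i ∙ ((gen u ^ k ∙ gen v) ∙ gen v)       ≈⟨ ∙-cong refl (assoc _ _ _) ⟩
    gen u ^ i ∙ (gen u ^ k ∙ (gen v ∙ gen v))       ≈⟨ ∙-cong refl (∙-cong refl v∙v) ⟩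
    gen u ^ i ∙ (gen u ^ k ∙ ε)                     ≈⟨ ∙-cong refl (identityʳ _) ⟩
    gen u ^ i ∙ gen u ^ k                           ≈⟨ ^-+ (gen u) i k ⟨
    gen u ^ (i ℕ.+ k)                               ∎)
    where
    k = j ℕ.* (m ℕ.∸ 1)
    open SetoidReasoning (Group.setoid (Dihedral m))
  normal (x ⁻¹) with normal x
  ... | rotation n p   = rotation (n ℕ.* (m ℕ.∸ 1)) (trans (⁻¹-cong p) (sym (inverseʳ-unique _ _ (u^-inverse n))))
    where open GroupProperties (Dihedral m) using (inverseʳ-unique)
  ... | reflection n p = reflection n (trans (⁻¹-cong p) (sym (inverseˡ-unique _ _ (begin
    (gen u ^ n ∙ gen v) ∙ (gen u ^ n ∙ gen v)       ≈⟨ assoc _ _ _ ⟩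
    gen u ^ n ∙ (gen v ∙ (gen u ^ n ∙ gen v))       ≈⟨ ∙-cong refl (assoc _ _ _) ⟨
    gen u ^ n ∙ ((gen v ∙ gen u ^ n) ∙ gen v)       ≈⟨ ∙-cong refl (∙-cong (v∙u^ n) refl) ⟩
    gen u ^ n ∙ ((gen u ^ k ∙ gen v) ∙ gen v)       ≈⟨ ∙-cong refl (assoc _ _ _) ⟩
    gen u ^ n ∙ (gen u ^ k ∙ (gen v ∙ gen v))       ≈⟨ ∙-cong refl (∙-cong refl v∙v) ⟩
    gen u ^ n ∙ (gen u ^ k ∙ ε)                     ≈⟨ ∙-cong refl (identityʳ _) ⟩
    gen u ^ n ∙ gen u ^ k                           ≈⟨ u^-inverse n ⟩
    ε                                               ∎))))
    where
    k = n ℕ.* (m ℕ.∸ 1)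
    open SetoidReasoning (Group.setoid (Dihedral m))

  u^residue : ∀ n → gen u ^ n ≃ gen u ^ residue (+ n)
  -- `residue (+ n)` is `n % m`, and the rest of `n` is a multiple of `m`.
  u^residue n = trans (subst (λ i → gen u ^ n ≃ gen u ^ i) (m≡m%n+[m/n]*n n m) refl)
    (trans (^-+ (gen u) (residue (+ n)) _) (trans (∙-cong refl (u^[k*m] (n ℕ./ m))) (identityʳ _)))

  u^-cong : ∀ {i j} → + i ≈ + j → gen u ^ i ≃ gen u ^ j
  u^-cong {i} {j} p = trans (u^residue i) (trans (subst (λ k → gen u ^ residue (+ i) ≃ gen u ^ k) (residue-cong p) refl) (sym (u^residue j)))

  eval-u^∙v : ∀ n → eval (gen u ^ n ∙ gen v) ≡ re (+ n)
  eval-u^∙v n = ≡.trans (cong (_· re (+ 0)) (eval-u^ n)) (cong re (ℤₚ.+-identityʳ (+ n)))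

  -- Between normal forms, `sound` forces the kinds to agree and the exponents to be congruent, and
  -- `u^m = e` identifies congruent powers. So the presented group has exactly the `2m` elements of
  -- the model.
  complete : ∀ {x y} → eval x ≋ eval y → x ≃ y
  complete {x} {y} p with normal x | normal y
  ... | rotation i q | rotation j r = trans q (trans (u^-cong (powers
          (≋-trans (≡⇒≋ (≡.sym (eval-u^ i))) (≋-trans (≋-sym (sound q)) (≋-trans p (≋-trans (sound r) (≡⇒≋ (eval-u^ j)))))))) (sym r))
    where
    powers : ∀ {a b} → ro a ≋ ro b → a ≈ b
    powers (ro e) = e
  ... | reflection i q | reflection j r = trans q (trans (∙-cong (u^-cong (powers
          (≋-trans (≡⇒≋ (≡.sym (eval-u^∙v i))) (≋-trans (≋-sym (sound q)) (≋-trans p (≋-trans (sound r) (≡⇒≋ (eval-u^∙v j)))))))) refl) (sym r))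
    where
    powers : ∀ {a b} → re a ≋ re b → a ≈ b
    powers (re e) = e
  ... | rotation i q | reflection j r with ≋-trans (≡⇒≋ (≡.sym (eval-u^ i))) (≋-trans (≋-sym (sound q)) (≋-trans p (≋-trans (sound r) (≡⇒≋ (eval-u^∙v j)))))
  ...   | ()
  complete {x} {y} p | reflection i q | rotation j r with ≋-trans (≡⇒≋ (≡.sym (eval-u^∙v i))) (≋-trans (≋-sym (sound q)) (≋-trans p (≋-trans (sound r) (≡⇒≋ (eval-u^ j)))))
  ...   | ()

  word : D → W
  word (ro a) = gen u ^ residue a
  word (re a) = gen u ^ residue a ∙ gen v

  eval-word : ∀ d → eval (word d) ≋ d
  eval-word (ro a) = ≋-trans (≡⇒≋ (eval-u^ (residue a))) (ro (≈-sym (≈residue a)))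
  eval-word (re a) = ≋-trans (≡⇒≋ (eval-u^∙v (residue a))) (re (≈-sym (≈residue a)))

-- From paths to sequencings.

open Pigeonhole

-- Carries distinctness along a pointwise relation, here from the vertices of a path to the partial
-- products that represent their translates.
module Transfer {A B : Set} {R : A → A → Set} {Q : B → B → Set} {P : B → A → Set}
  (preserves : ∀ {x x′ y y′} → P x y → P x′ y′ → R y y′ → Q x x′) where

  transfer-All : ∀ {x y xs ys} → P x y → Pointwise P xs ys → All (R y) ys → All (Q x) xs
  transfer-All p []       []       = []
  transfer-All p (q ∷ qs) (r ∷ rs) = preserves p q r ∷ transfer-All p qs rs

  transfer-AllPairs : ∀ {xs ys} → Pointwise P xs ys → AllPairs R ys → AllPairs Q xs
  transfer-AllPairs []       []       = []
  transfer-AllPairs (p ∷ ps) (r ∷ rs) = transfer-All p ps r ∷ transfer-AllPairs ps rs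

scanl-∷ : ∀ {A B : Set} (f : A → B → A) e x xs → scanl f e (x ∷ xs) ≡ e ∷ scanl f (f e x) xs
scanl-∷ f e x xs = ≡.trans (scanl-defn f e (x ∷ xs))
  (cong (e ∷_) (≡.trans (≡.sym (map-∘ (inits xs))) (≡.sym (scanl-defn f (f e x) xs))))

module Sequencing (ℓ : ℕ) where
  open Paths ℓ
  open DihedralGroup ℓ

  order : ℕ
  order = m ℕ.+ m

  order≡ : order ≡ suc (suc (8 ℕ.* ℓ))
  order≡ = eq ℓ
    where
    eq : ∀ l → 4 ℕ.* l ℕ.+ 1 ℕ.+ (4 ℕ.* l ℕ.+ 1) ≡ suc (suc (8 ℕ.* l))
    eq = ℕ-solve-∀

  code< : ∀ d → code d ℕ.< order
  code< (ro a) = ℕₚ.<-≤-trans (residue<m a) (ℕₚ.m≤m+n m m)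
  code< (re a) = ℕₚ.+-monoʳ-< m (residue<m a)

  0<m : 0 ℕ.< m
  0<m = ℕₚ.m≤n+m 1 (4 ℕ.* ℓ)

  code-identity : code (ro (+ 0)) ≡ 0
  code-identity = <m-≈⇒≡ (residue<m (+ 0)) 0<m (≈-sym (≈residue (+ 0)))

  decode : ∀ k → k ℕ.< order → ∃[ d ] code d ≡ k
  decode k k<2m with k ℕₚ.<? m
  ... | yes k<m = ro (+ k) , <m-≈⇒≡ (residue<m (+ k)) k<m (≈-sym (≈residue (+ k)))
  ... | no  k≮m with ℕₚ.m≤n⇒∃[o]m+o≡n (ℕₚ.≮⇒≥ k≮m)
  ...   | o , refl = re (+ o) , cong (m ℕ.+_) (<m-≈⇒≡ (residue<m (+ o)) (ℕₚ.+-cancelˡ-< m o m k<2m) (≈-sym (≈residue (+ o))))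

  wordCode : W → ℕ
  wordCode = code ∘ eval

  wordCode-cong : ∀ {x y} → x ≃ y → wordCode x ≡ wordCode y
  wordCode-cong = code-cong ∘ sound

  wordCode-injective : ∀ {x y} → wordCode x ≡ wordCode y → x ≃ y
  wordCode-injective = complete ∘ code-injective

  wordCode-word : ∀ d → wordCode (word d) ≡ code d
  wordCode-word d = code-cong (eval-word d)

  length-labels : ∀ d ds → length (labels (d ∷ ds)) ≡ length ds
  length-labels d []       = refl
  length-labels d (e ∷ ds) = cong suc (length-labels e ds)

  module _ {e : D} (π : Path e) where
    open Path π

    private
      steps-codes : List ℕ
      steps-codes = map code (labels vertices)

      codes : List ℕ
      codes = 0 ∷ code e ∷ steps-codes

      length-labels-vertices : ∀ ds → length ds ≡ suc (8 ℕ.* ℓ) → length (labels ds) ≡ 8 ℕ.* ℓ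
      length-labels-vertices (d ∷ ds) eq = ≡.trans (length-labels d ds) (ℕₚ.suc-injective eq)

      length-codes : length codes ℕ.≤ length (upTo order)
      length-codes = ℕₚ.≤-reflexive (≡.trans (cong (suc ∘ suc) (≡.trans (length-map code (labels vertices))
        (length-labels-vertices vertices length-vertices))) (≡.trans (≡.sym order≡) (≡.sym (length-upTo order))))

      covered : ∀ {k} → k ∈ upTo order → k ∈ codes
      covered {k} k∈ with decode k (∈-upTo⁻ k∈)
      ... | d , refl with steps d
      ...   | inj₁ p        = here (≡.trans (code-cong p) code-identity)
      ...   | inj₂ (inj₁ p) = there (here (code-cong p))
      ...   | inj₂ (inj₂ s) = there (there (Anyₚ.map⁺ (Any.map code-cong (Step⇒Any s))))

      -- The list has `2 + 8ℓ` entries and covers all `8ℓ + 2` codes. Its freedom from repeats says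
      -- at once that the steps are distinct and that none is the identity or `e`.
      codes! : Unique codes
      codes! = covering⇒unique (upTo⁺ order) covered length-codes

    covered-step : ∀ x → wordCode x ≢ 0 → wordCode x ≢ code e → Any (λ d → wordCode x ≡ code d) (labels vertices)
    covered-step x ≢0 ≢e with covered (∈-upTo⁺ (code< (eval x)))
    ... | here p          = contradiction p ≢0
    ... | there (here p)  = contradiction p ≢e
    ... | there (there p) = Anyₚ.map⁻ p

    step-avoids : ∀ {d} → d ∈ labels vertices → code d ≢ 0 × code d ≢ code e
    step-avoids {d} d∈ =
      (λ p → All.lookup (All.tail (AllPairs.head codes!)) (∈-map⁺ code d∈) (≡.sym p)) ,
      (λ p → All.lookup (AllPairs.head (AllPairs.tail codes!)) (∈-map⁺ code d∈) (≡.sym p))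

    labels! : AllPairs (λ d d′ → code d ≢ code d′) (labels vertices)
    labels! = AllPairsₚ.map⁻ (AllPairs.tail (AllPairs.tail codes!))

    -- The same count, with the unvisited element put in front of the `8ℓ + 1` vertices.
    vertices! : AllPairs (λ d d′ → code d ≢ code d′) vertices
    vertices! = AllPairsₚ.map⁻ (AllPairs.tail (covering⇒unique (upTo⁺ order) visited length≤))
      where
      visited : ∀ {k} → k ∈ upTo order → k ∈ code unvisited ∷ map code vertices
      visited {k} k∈ with decode k (∈-upTo⁻ k∈)
      ... | d , refl with visits d
      ...   | inj₁ p            = here (code-cong p)
      ...   | inj₂ (x , x∈ , p) = there (subst (_∈ map code vertices) (≡.sym (code-cong p)) (∈-map⁺ code x∈))
      length≤ : suc (length (map code vertices)) ℕ.≤ length (upTo order)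
      length≤ = ℕₚ.≤-reflexive (≡.trans (cong suc (≡.trans (length-map code vertices) length-vertices))
        (≡.trans (≡.sym order≡) (≡.sym (length-upTo order))))

    sequence : List W
    sequence = map word (labels vertices)

    -- Left translation moves the path so that it starts at the identity.
    partialProducts-translate : ∀ a acc d ds → eval acc ≋ a · d →
      Pointwise (λ x d → eval x ≋ a · d) (scanl _∙_ acc (map word (labels (d ∷ ds)))) (d ∷ ds)
    partialProducts-translate a acc d []        p = p ∷ []
    partialProducts-translate a acc d (d′ ∷ ds) p =
      subst (λ xs → Pointwise (λ x d → eval x ≋ a · d) xs (d ∷ d′ ∷ ds))
        (≡.sym (scanl-∷ _∙_ acc (word (d \\ d′)) (map word (labels (d′ ∷ ds)))))
        (p ∷ partialProducts-translate a (acc ∙ word (d \\ d′)) d′ ds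
          (≋-trans (·-cong p (eval-word (d \\ d′))) (≡⇒≋ (cancel-\\ a d d′))))

    distinct-partialProducts : AllPairs (λ x y → ¬ x ≃ y) (partialProducts (Dihedral m) sequence)
    distinct-partialProducts = from-start vertices length-vertices vertices!
      where
      from-start : ∀ ds → length ds ≡ suc (8 ℕ.* ℓ) → AllPairs (λ d d′ → code d ≢ code d′) ds →
        AllPairs (λ x y → ¬ x ≃ y) (scanl _∙_ ε (map word (labels ds)))
      -- Translation by the inverse of the first vertex `d` makes the path start at the identity;
      -- cancelling it turns equal partial products into equal vertices.
      from-start (d ∷ ds) _ ds! = Transfer.transfer-AllPairs
        (λ p p′ d≢d′ x≃y → d≢d′ (code-cong (·-cancelˡ (inv d) (≋-trans (≋-sym p) (≋-trans (sound x≃y) p′)))))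
        (partialProducts-translate (inv d) ε d ds (≡⇒≋ (≡.sym (inv-· d)))) ds!

    distinct-sequence : AllPairs (λ x y → ¬ x ≃ y) sequence
    distinct-sequence = AllPairsₚ.map⁺ (AllPairs.map (λ {d} {d′} d≢d′ p →
      d≢d′ (≡.trans (≡.sym (wordCode-word d)) (≡.trans (wordCode-cong p) (wordCode-word d′)))) labels!)

    ∈-sequence : ∀ {x} → wordCode x ≢ 0 → wordCode x ≢ code e → Any (x ≃_) sequence
    ∈-sequence {x} ≢0 ≢e = Anyₚ.map⁺ (Any.map (λ {d} p → wordCode-injective (≡.trans p (≡.sym (wordCode-word d)))) (covered-step x ≢0 ≢e))

    sequence-avoids : ∀ {x} → Any (x ≃_) sequence → wordCode x ≢ 0 × wordCode x ≢ code e
    sequence-avoids {x} x∈ with find (Anyₚ.map⁻ x∈)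
    ... | d , d∈ , x≃d with step-avoids d∈
    ...   | ≢0 , ≢e = (λ p → ≢0 (≡.trans (≡.sym x≡d) p)) , (λ p → ≢e (≡.trans (≡.sym x≡d) p))
      where
      x≡d : wordCode x ≡ code d
      x≡d = ≡.trans (wordCode-cong x≃d) (wordCode-word d)

  module _ {s : Level} (S : Pred W s) (S⊆ : S ⊆ NonIdentity (Dihedral m))
           (cardinality : HasCardinality (Dihedral m) S (8 ℕ.* ℓ)) where
    private
      elements : List W
      elements = proj₁ cardinality

      elementCodes : List ℕ
      elementCodes = map wordCode elements

      S⇒Any : ∀ {x} → S x → Any (x ≃_) elements
      S⇒Any {x} = Equivalence.from (proj₂ (proj₁ (proj₂ cardinality)) x)

      Any⇒S : ∀ {x} → Any (x ≃_) elements → S x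
      Any⇒S {x} = Equivalence.to (proj₂ (proj₁ (proj₂ cardinality)) x)

      S⇒∈ : ∀ {x} → S x → wordCode x ∈ elementCodes
      S⇒∈ Sx = Anyₚ.map⁺ (Any.map wordCode-cong (S⇒Any Sx))

      ∈⇒S : ∀ {x} → wordCode x ∈ elementCodes → S x
      ∈⇒S x∈ = Any⇒S (Any.map wordCode-injective (Anyₚ.map⁻ x∈))

      S⇒≢0 : ∀ {x} → S x → wordCode x ≢ 0
      S⇒≢0 Sx p = S⊆ Sx (wordCode-injective (≡.trans p (≡.sym code-identity)))

      0∉ : 0 ∉ elementCodes
      0∉ 0∈ = S⇒≢0 {ε} (∈⇒S {ε} (subst (_∈ elementCodes) (≡.sym code-identity) 0∈)) code-identity

      codes! : Unique (0 ∷ elementCodes)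
      codes! = ¬Any⇒All¬ elementCodes 0∉ ∷
        AllPairsₚ.map⁺ (AllPairs.map (λ x≄y p → x≄y (wordCode-injective p)) (proj₁ (proj₁ (proj₂ cardinality))))

      length-codes : length elementCodes ≡ 8 ℕ.* ℓ
      length-codes = ≡.trans (length-map wordCode elements) (proj₂ (proj₂ cardinality))

      -- The identity and `S` account for only `8ℓ + 1` of the `8ℓ + 2` codes.
      omitted : ∃[ k ] (k ℕ.< order × k ∉ 0 ∷ elementCodes)
      omitted with all? (λ k → _∈?_ ℕₚ._≟_ k (0 ∷ elementCodes)) (upTo order)
      ... | yes all = contradiction
        (unique⊆⇒length≤ (upTo⁺ order) (All.lookup all))
        (ℕₚ.<⇒≱ (ℕₚ.≤-reflexive (≡.trans (cong (suc ∘ suc) length-codes) (≡.trans (≡.sym order≡) (≡.sym (length-upTo order))))))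
      ... | no ¬all with find (¬All⇒Any¬ (λ k → _∈?_ ℕₚ._≟_ k (0 ∷ elementCodes)) (upTo order) ¬all)
      ...   | k , k∈ , k∉ = k , ∈-upTo⁻ k∈ , k∉

      -- If `j` were missing as well, then `j`, `k`, `0` and the codes of `S` would be `8ℓ + 3`
      -- distinct numbers below `8ℓ + 2`.
      others∈ : ∀ {k} → k ∉ 0 ∷ elementCodes → k ℕ.< order → ∀ {j} → j ℕ.< order → j ≢ 0 → j ≢ k → j ∈ elementCodes
      others∈ {k} k∉ k< {j} j< j≢0 j≢k with _∈?_ ℕₚ._≟_ j elementCodes
      ... | yes j∈ = j∈
      ... | no  j∉ = contradiction
        (unique⊆⇒length≤ (¬Any⇒All¬ (k ∷ 0 ∷ elementCodes) j∉′ ∷ ¬Any⇒All¬ (0 ∷ elementCodes) k∉ ∷ codes!) ⊆upTo)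
        (ℕₚ.<⇒≱ (s≤s (ℕₚ.≤-reflexive (≡.trans (length-upTo order) (≡.trans order≡ (cong (suc ∘ suc) (≡.sym length-codes)))))))
        where
        j∉′ : j ∉ k ∷ 0 ∷ elementCodes
        j∉′ (here p)          = j≢k p
        j∉′ (there (here p))  = j≢0 p
        j∉′ (there (there p)) = j∉ p
        ⊆upTo : ∀ {i} → i ∈ j ∷ k ∷ 0 ∷ elementCodes → i ∈ upTo order
        ⊆upTo (here refl)                 = ∈-upTo⁺ j<
        ⊆upTo (there (here refl))         = ∈-upTo⁺ k<
        ⊆upTo (there (there (here refl))) = ∈-upTo⁺ (ℕₚ.≤-trans 0<m (ℕₚ.m≤m+n m m))
        ⊆upTo (there (there (there i∈))) with ∈-map⁻ wordCode i∈
        ... | x , _ , refl = ∈-upTo⁺ (code< (eval x))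

    -- By `others∈` the set `S` consists of everything but the identity and `e`, as do the steps of
    -- a path avoiding `e`.
    fromPath : ∀ {e} → code e ∉ 0 ∷ elementCodes → Path e → HasSequencing (Dihedral m) S
    fromPath {e} e∉ π = sequence π , (distinct-sequence π , λ x → mk⇔ (to x) from) , distinct-partialProducts π
      where
      to : ∀ x → Any (x ≃_) (sequence π) → S x
      to x x∈ = ∈⇒S (others∈ e∉ (code< e) (code< (eval x)) (proj₁ (sequence-avoids π x∈)) (proj₂ (sequence-avoids π x∈)))
      from : ∀ {x} → S x → Any (x ≃_) (sequence π)
      from {x} Sx = ∈-sequence π (S⇒≢0 Sx) (λ p → e∉ (there (subst (_∈ elementCodes) p (S⇒∈ Sx))))

    hasSequencing : (∀ e → ¬ e ≋ ro (+ 0) → Path e) → HasSequencing (Dihedral m) S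
    hasSequencing paths = from-omitted omitted
      where
      from-omitted : ∃[ k ] (k ℕ.< order × k ∉ 0 ∷ elementCodes) → HasSequencing (Dihedral m) S
      from-omitted (k , k< , k∉) = fromPath e∉ (paths e (λ e≋1 → e∉ (here (≡.trans (code-cong e≋1) code-identity))))
        where
        e : D
        e = proj₁ (decode k k<)
        e∉ : code e ∉ 0 ∷ elementCodes
        e∉ = subst (_∉ 0 ∷ elementCodes) (≡.sym (proj₂ (decode k k<))) k∉

open import Data.Nat.Base using (_+_; _*_; _<_)

theorem5p3 : GvözdjakConjecture →
    ∀ (ℓ : ℕ) → 0 < ℓ →
    ∀ {s : Level} (S : Pred (Group.Carrier (Dihedral (4 * ℓ + 1))) s) →
    S ⊆ NonIdentity (Dihedral (4 * ℓ + 1)) →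
    HasCardinality (Dihedral (4 * ℓ + 1)) S (8 * ℓ) →
    HasSequencing (Dihedral (4 * ℓ + 1)) S
theorem5p3 conjecture ℓ 0<ℓ S S⊆ cardinality =
  Sequencing.hasSequencing ℓ S S⊆ cardinality (FromConjecture.everyPath conjecture ℓ 0<ℓ)
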